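{- Let $0\le q<1$, let $n,m\ge 1$, let $A=(w_{\ell,j})_{1\le \ell\le n,\,1\le j\le m}$ be a matrix of nonnegative integers and let $A'$ be its transpose (an $m\times n$ matrix). For a pair $(P,Q)$ of Gelfand-Tsetlin patterns write $\phi_A(P,Q)=\mathbb P(q\mathrm{RSK}(A)=(P,Q))$. Then for all $P,Q$, $$\phi_A(P,Q)=\phi_{A'}(Q,P).$$
   Context: Notation: $(\alpha;q)_k=\prod_{i=0}^{k-1}(1-\alpha q^i)$ (empty product $=1$), $(\alpha;q)_\infty=\prod_{i\ge0}(1-\alpha q^i)$, $(k)_q:=(q;q)_k$, with the convention $0^0=1$. For $m_1,k\in\mathbb N$, $m_2\in\mathbb N\cup\{\infty\}$, $m_1+m_2\ge k$, the $q$-hypergeometric distribution $q\mathrm{Hyp}(m_1,m_2,k)$ has pmf $\ell\mapsto q^{(m_1-\ell)(k-\ell)}\binom{m_1}{\ell}_q\binom{m_2}{k-\ell}_q\big/\binom{m_1+m_2}{k}_q$ on $\max(0,k-m_2)\le \ell\le \min(m_1,k)$, where $\binom{a}{b}_q=\frac{(a)_q}{(b)_q(a-b)_q}$; for $m_2=\infty$ it is $\ell\mapsto q^{(m_1-\ell)(k-\ell)}\frac{(m_1)_q(k)_q}{(\ell)_q(m_1-\ell)_q(k-\ell)_q}$, $0\le \ell\le\min(m_1,k)$. A Gelfand-Tsetlin (GT) pattern with $m$ levels is an array $(\lambda^j_k)_{1\le k\le j\le m}$ of nonnegative integers with $\lambda^{j+1}_{k+1}\le\lambda^j_k\le\lambda^{j+1}_k$.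 Conventions: $\lambda^j_0=+\infty$, $\lambda^j_k=0$ for $k>j$, and all level-$0$ entries $\lambda^0_k$ ($k\ge1$) are $0$. $q$RSK insertion of a row $(a_1,\dots,a_m)\in\mathbb N^m$ into a GT pattern $\lambda$ with $m$ levels produces a random GT pattern $\tilde\lambda$: set $a^j_1=a_j$; for $j=1,\dots,m$ and, for each $j$, for $k=1,\dots,j$ in increasing order: if $k<j$, sample $a^j_{k+1}\sim q\mathrm{Hyp}(\tilde\lambda^{j-1}_k-\lambda^{j-1}_k,\ \lambda^{j-1}_{k-1}-\tilde\lambda^{j-1}_k,\ \lambda^j_k-\lambda^{j-1}_k)$ independently of everything else given the previously computed quantities, and set $\tilde\lambda^j_k=a^j_k+\lambda^j_k+\tilde\lambda^{j-1}_k-\lambda^{j-1}_k-a^j_{k+1}$; if $k=j$, set $\tilde\lambda^j_j=\lambda^j_j+a^j_j$. $q$RSK of an $n\times m$ matrix $w$: start from $\lambda(0)\equiv0$ and for $\ell=1,\dots,n$ let $\lambda(\ell)$ be the insertion (with fresh independent randomness) of row $(w_{\ell,1},\dots,w_{\ell,m})$ into $\lambda(\ell-1)$. The output is the pair $(P,Q)$ with $P=(\lambda^j_k(n))_{1\le k\le j\le m}$ (GT pattern with $m$ levels) and $Q=(\lambda^m_k(\ell))_{1\le k\le \ell\le n}$ (GT pattern with $n$ levels; entries with $k>m$ are $0$).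
   Formalization: The parameter $q$ is taken to be rational, with $0\le q<1$. -}

module Defs where

open import Data.Nat as ℕ using (ℕ; zero; suc; _∸_; _⊓_; _≡ᵇ_)
open import Data.Bool using (Bool; true; false; _∧_; if_then_else_)
open import Data.List using (List; []; _∷_; map; upTo; concatMap; foldr)
open import Data.Product using (_×_; _,_; proj₁; proj₂)
open import Data.Rational using (ℚ; 0ℚ; 1ℚ; _+_; _*_; _-_; _÷_; ≢-nonZero)
open import Data.Rational.Properties using (_≟_)
open import Relation.Nullary using (yes; no)

-- A triangular array λ^j_k is stored as a function (j k : ℕ) → ℕ, using
-- 1-based indices; only the entries with 1 ≤ k ≤ j ≤ (number of levels)
-- are meaningful.  An n × m matrix w_{ℓ,j} is stored the same way.
Tab : Set
Tab = ℕ → ℕ → ℕ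

Matrix : Set
Matrix = ℕ → ℕ → ℕ

transpose : Matrix → Matrix
transpose w ℓ j = w j ℓ

entry : Tab → ℕ → ℕ → ℕ
entry L j k with j ℕ.<ᵇ k
... | true  = 0
... | false = L j k

IsGT : ℕ → Tab → Set
IsGT m L = ∀ j k → 1 ℕ.≤ k → k ℕ.≤ j → suc j ℕ.≤ m →
  (entry L (suc j) (suc k) ℕ.≤ entry L j k) × (entry L j k ℕ.≤ entry L (suc j) k)

range : ℕ → ℕ → List ℕ
range lo hi = map (lo ℕ.+_) (upTo (suc hi ∸ lo))

allL : {A : Set} → (A → Bool) → List A → Bool
allL p []       = true
allL p (x ∷ xs) = p x ∧ allL p xs

agree : ℕ → Tab → Tab → Bool
agree m X Y = allL (λ j → allL (λ k → X j k ≡ᵇ Y j k) (range 1 j)) (range 1 m)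

pow : ℚ → ℕ → ℚ
pow x zero    = 1ℚ          -- so 0^0 = 1
pow x (suc n) = x * pow x n

-- division; the denominators occurring below are nonzero for 0 ≤ q < 1,
-- the fallback value 0 is never used in that regime
div : ℚ → ℚ → ℚ
div x y with y ≟ 0ℚ
... | yes _  = 0ℚ
... | no y≢0 = _÷_ x y {{≢-nonZero y≢0}}

qfact : ℚ → ℕ → ℚ
qfact q zero    = 1ℚ
qfact q (suc k) = qfact q k * (1ℚ - pow q (suc k))

qbinom : ℚ → ℕ → ℕ → ℚ
qbinom q a b = div (qfact q a) (qfact q b * qfact q (a ∸ b))

data ℕ∞ : Set where
  fin : ℕ → ℕ∞
  ∞   : ℕ∞

Dist : Set → Set
Dist A = List (ℚ × A)

ret : {A : Set} → A → Dist A
ret a = (1ℚ , a) ∷ []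

bind : {A B : Set} → Dist A → (A → Dist B) → Dist B
bind d f = concatMap (λ { (p , a) → map (λ { (r , b) → (p * r , b) }) (f a) }) d

prob : {A : Set} → Dist A → (A → Bool) → ℚ
prob d e = foldr (λ { (p , a) s → (if e a then p else 0ℚ) + s }) 0ℚ d

qHyp : ℚ → ℕ → ℕ∞ → ℕ → Dist ℕ
qHyp q m1 (fin m2) k =
  map (λ l → ( div (pow q ((m1 ∸ l) ℕ.* (k ∸ l)) * qbinom q m1 l * qbinom q m2 (k ∸ l))
                   (qbinom q (m1 ℕ.+ m2) k) , l ))
      (range (k ∸ m2) (m1 ⊓ k))
qHyp q m1 ∞ k =
  map (λ l → ( div (pow q ((m1 ∸ l) ℕ.* (k ∸ l)) * qfact q m1 * qfact q k)
                   (qfact q l * qfact q (m1 ∸ l) * qfact q (k ∸ l)) , l ))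
      (range 0 (m1 ⊓ k))

upd : Tab → ℕ → ℕ → ℕ → Tab
upd t j k v j' k' = if (j' ≡ᵇ j) ∧ (k' ≡ᵇ k) then v else t j' k'

-- Processing level j of the insertion, at position k with r = j - k
-- positions remaining; c = a^j_k; lam = old pattern λ; t = new pattern
-- λ̃ built so far (levels < j already final, level-0 entries are 0).
insLevel : ℚ → Tab → (j r k : ℕ) → ℕ → Tab → Dist Tab
insLevel q lam j zero    k c t = ret (upd t j k (lam j k ℕ.+ c))
insLevel q lam j (suc r) k c t =
  bind (qHyp q (t (j ∸ 1) k ∸ lam (j ∸ 1) k)
               (m2 k)
               (lam j k ∸ lam (j ∸ 1) k))
       (λ x → insLevel q lam j r (suc k) x
                (upd t j k ((c ℕ.+ lam j k ℕ.+ t (j ∸ 1) k) ∸ (lam (j ∸ 1) k ℕ.+ x))))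
  where
  -- λ^{j-1}_{k-1} - λ̃^{j-1}_k, with λ^{j-1}_0 = +∞
  m2 : ℕ → ℕ∞
  m2 zero    = ∞
  m2 (suc zero) = ∞
  m2 (suc (suc k')) = fin (lam (j ∸ 1) (suc k') ∸ t (j ∸ 1) (suc (suc k')))

insLevels : ℚ → Tab → (ℕ → ℕ) → (s j : ℕ) → Tab → Dist Tab
insLevels q lam a zero    j t = ret t
insLevels q lam a (suc s) j t =
  bind (insLevel q lam j (j ∸ 1) 1 (a j) t) (λ t' → insLevels q lam a s (suc j) t')

insert : ℚ → (m : ℕ) → Tab → (ℕ → ℕ) → Dist Tab
insert q m lam a = insLevels q lam a m 1 lam

zeroTab : Tab
zeroTab _ _ = 0

-- rows ℓ, ℓ+1, …, ℓ+s-1 of w; state (λ(ℓ-1), Q-so-far)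
rskRows : ℚ → (m : ℕ) → Matrix → (s ℓ : ℕ) → Tab × Tab → Dist (Tab × Tab)
rskRows q m w zero    ℓ st = ret st
rskRows q m w (suc s) ℓ (lam , Q) =
  bind (insert q m lam (w ℓ))
       (λ lam' → rskRows q m w s (suc ℓ)
                   (lam' , (λ ℓ' k → if ℓ' ≡ᵇ ℓ then lam' m k else Q ℓ' k)))

qRSK : ℚ → (n m : ℕ) → Matrix → Dist (Tab × Tab)
qRSK q n m w = rskRows q m w n 1 (zeroTab , zeroTab)

phi : ℚ → (n m : ℕ) → Matrix → Tab → Tab → ℚ
phi q n m w P Q = prob (qRSK q n m w) (λ { (P' , Q') → agree m P P' ∧ agree n Q Q' })

{-# OPTIONS --safe #-}
-- Run qRSK of an n × m matrix w on a grid whose cell (ℓ, j) holds level j of the pattern after ℓ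
-- insertions. That row is sampled, given w ℓ j, from the three rows at (ℓ-1, j-1), (ℓ, j-1) and
-- (ℓ-1, j) alone; qRSK of the transpose fills the transposed grid with the same local rule, except
-- that the two neighbours (ℓ, j-1) and (ℓ-1, j) swap roles. The local rule is symmetric under this
-- swap: with N = μ_{k-1} - μ_k, each q-hypergeometric draw has the form qHyp(a, N - a, b), which is
-- symmetric in a and b, the new entries are symmetric in the two neighbours, and past the shorter
-- neighbour the draws are 0. The symmetry needs the neighbours to interlace, which holds because
-- the rows produced by qRSK form GT patterns. Finally, cells that do not read each other's
-- positions can be sampled in either order, so filling the grid row by row (qRSK of w) and column
-- by column (qRSK of its transpose) gives the same distribution.
module Submission where

open import Defs
open import Data.Bool using (Bool; true; false; if_then_else_; _∧_)
open import Data.Bool.Properties using (∧-comm)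
open import Data.Empty using (⊥-elim)
open import Data.List using (List; []; _∷_; map; _++_)
open import Data.List.Properties using (map-cong; map-cong-local)
open import Data.List.Relation.Unary.All as All using (All; []; _∷_)
import Data.List.Relation.Unary.All.Properties as All
open import Data.Nat as ℕ using (ℕ; zero; suc; _+_; _∸_; _⊓_; _≤_; _<_; _≡ᵇ_; z≤n; s≤s)
import Data.Nat.Properties as ℕ
open import Algebra.Properties.CommutativeSemigroup ℕ.+-commutativeSemigroup using () renaming (xy∙z≈xz∙y to +-xy∙z≈xz∙y)
import Data.Nat.Solver as ℕ-Solver
open import Data.Product using (_×_; _,_; proj₁; proj₂)
open import Data.Rational as ℚ using (ℚ; 0ℚ; 1ℚ; _*_; _-_; Positive) renaming (_≤_ to _≤ℚ_; _<_ to _<ℚ_)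
open import Data.Rational.Properties
import Data.Rational.Solver as ℚ-Solver
open import Data.Sum using (_⊎_; inj₁; inj₂)
open import Function using (_∘_)
open import Relation.Binary.Core using (_Preserves_⟶_)
open import Relation.Binary.Definitions using (tri<; tri≈; tri>)
open import Relation.Binary.PropositionalEquality
open import Relation.Nullary using (Dec; yes; no)

𝔼 : {A : Set} → Dist A → (A → ℚ) → ℚ
𝔼 []            f = 0ℚ
𝔼 ((p , a) ∷ d) f = p * f a ℚ.+ 𝔼 d f

module _ {A : Set} where

  𝔼-cong : (d : Dist A) {f g : A → ℚ} → f ≗ g → 𝔼 d f ≡ 𝔼 d g
  𝔼-cong []            f≗g = refl
  𝔼-cong ((p , a) ∷ d) f≗g = cong₂ (λ u v → p * u ℚ.+ v) (f≗g a) (𝔼-cong d f≗g)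

  𝔼-++ : (d e : Dist A) (f : A → ℚ) → 𝔼 (d ++ e) f ≡ 𝔼 d f ℚ.+ 𝔼 e f
  𝔼-++ []            e f = sym (+-identityˡ _)
  𝔼-++ ((p , a) ∷ d) e f =
    trans (cong (p * f a ℚ.+_) (𝔼-++ d e f)) (sym (+-assoc (p * f a) (𝔼 d f) (𝔼 e f)))

  -- stated for any h acting as (r , b) ↦ (p * r , b), as the one inside bind is an anonymous lambda
  𝔼-scale : (p : ℚ) {h : ℚ × A → ℚ × A} → (∀ r b → h (r , b) ≡ (p * r , b)) →
            (d : Dist A) (f : A → ℚ) → 𝔼 (map h d) f ≡ p * 𝔼 d f
  𝔼-scale p h≡ []            f = sym (*-zeroʳ p)
  𝔼-scale p h≡ ((r , b) ∷ d) f rewrite h≡ r b = begin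
    p * r * f b ℚ.+ 𝔼 (map _ d) f  ≡⟨ cong₂ ℚ._+_ (*-assoc p r (f b)) (𝔼-scale p h≡ d f) ⟩
    p * (r * f b) ℚ.+ p * 𝔼 d f    ≡⟨ sym (*-distribˡ-+ p _ _) ⟩
    p * (r * f b ℚ.+ 𝔼 d f)        ∎
    where open ≡-Reasoning

  𝔼-ret : (a : A) (f : A → ℚ) → 𝔼 (ret a) f ≡ f a
  𝔼-ret a f = trans (+-identityʳ _) (*-identityˡ _)

  𝔼-zero : (d : Dist A) → 𝔼 d (λ _ → 0ℚ) ≡ 0ℚ
  𝔼-zero []            = refl
  𝔼-zero ((p , a) ∷ d) = trans (cong₂ ℚ._+_ (*-zeroʳ p) (𝔼-zero d)) (+-identityˡ 0ℚ)

  𝔼-linear : (d : Dist A) (c : ℚ) (f g : A → ℚ) → 𝔼 d (λ a → c * f a ℚ.+ g a) ≡ c * 𝔼 d f ℚ.+ 𝔼 d g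
  𝔼-linear []            c f g = sym (trans (+-identityʳ _) (*-zeroʳ c))
  𝔼-linear ((p , a) ∷ d) c f g =
    trans (cong (p * (c * f a ℚ.+ g a) ℚ.+_) (𝔼-linear d c f g)) (regroup c p (f a) (g a) (𝔼 d f) (𝔼 d g))
    where
    open ℚ-Solver.+-*-Solver using (solve; _:+_; _:*_; _:=_)
    regroup : ∀ c p x y u v → p * (c * x ℚ.+ y) ℚ.+ (c * u ℚ.+ v) ≡ c * (p * x ℚ.+ u) ℚ.+ (p * y ℚ.+ v)
    regroup = solve 6 (λ c p x y u v → p :* (c :* x :+ y) :+ (c :* u :+ v) := c :* (p :* x :+ u) :+ (p :* y :+ v)) refl

𝔼-bind : {A B : Set} (d : Dist A) (g : A → Dist B) (f : B → ℚ) → 𝔼 (bind d g) f ≡ 𝔼 d (λ a → 𝔼 (g a) f)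
𝔼-bind []            g f = refl
𝔼-bind ((p , a) ∷ d) g f =
  trans (𝔼-++ (map _ (g a)) _ f) (cong₂ ℚ._+_ (𝔼-scale p (λ _ _ → refl) (g a) f) (𝔼-bind d g f))

𝔼-comm : {A B : Set} (d : Dist A) (e : Dist B) (F : A → B → ℚ) →
         𝔼 d (λ a → 𝔼 e (F a)) ≡ 𝔼 e (λ b → 𝔼 d (λ a → F a b))
𝔼-comm []            e F = sym (𝔼-zero e)
𝔼-comm ((p , a) ∷ d) e F =
  trans (cong (p * 𝔼 e (F a) ℚ.+_) (𝔼-comm d e F)) (sym (𝔼-linear e p (F a) (λ b → 𝔼 d (λ a' → F a' b))))

indicator : {A : Set} → (A → Bool) → A → ℚ
indicator e a = if e a then 1ℚ else 0ℚ

prob≡𝔼-indicator : {A : Set} (d : Dist A) (e : A → Bool) → prob d e ≡ 𝔼 d (indicator e)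
prob≡𝔼-indicator []            e = refl
prob≡𝔼-indicator ((p , a) ∷ d) e = cong₂ ℚ._+_ (weight (e a)) (prob≡𝔼-indicator d e)
  where
  weight : (b : Bool) → (if b then p else 0ℚ) ≡ p * (if b then 1ℚ else 0ℚ)
  weight true  = sym (*-identityʳ p)
  weight false = sym (*-zeroʳ p)

Supported : {A : Set} → (A → Set) → Dist A → Set
Supported P = All (P ∘ proj₂)

𝔼-cong-supported : {A : Set} {P : A → Set} (d : Dist A) {f g : A → ℚ} → Supported P d →
                   (∀ a → P a → f a ≡ g a) → 𝔼 d f ≡ 𝔼 d g
𝔼-cong-supported []            []         f≡g = refl
𝔼-cong-supported ((p , a) ∷ d) (pa ∷ all) f≡g =
  cong₂ (λ u v → p * u ℚ.+ v) (f≡g a pa) (𝔼-cong-supported d all f≡g)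

supported-ret : {A : Set} {P : A → Set} {a : A} → P a → Supported P (ret a)
supported-ret pa = pa ∷ []

supported-reweight : {A : Set} {P : A → Set} {h : ℚ × A → ℚ × A} → (∀ r a → proj₂ (h (r , a)) ≡ a) →
                     (d : Dist A) → Supported P d → Supported P (map h d)
supported-reweight h₂≡ []            []         = []
supported-reweight {P = P} h₂≡ ((r , a) ∷ d) (pa ∷ all) =
  subst P (sym (h₂≡ r a)) pa ∷ supported-reweight h₂≡ d all

supported-bind : {A B : Set} {P : A → Set} {Q : B → Set} (d : Dist A) (g : A → Dist B) →
                 Supported P d → (∀ a → P a → Supported Q (g a)) → Supported Q (bind d g)
supported-bind []            g []         sup-g = []
supported-bind ((p , a) ∷ d) g (pa ∷ all) sup-g =
  All.++⁺ (supported-reweight (λ _ _ → refl) (g a) (sup-g a pa)) (supported-bind d g all sup-g)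

-- With the junk value inv 0 = 0, inv is multiplicative without side conditions.
inv : ℚ → ℚ
inv = div 1ℚ

div≡*inv : ∀ x y → div x y ≡ x * inv y
div≡*inv x y with y ≟ 0ℚ
... | yes _ = sym (*-zeroʳ x)
... | no  _ = cong (x *_) (sym (*-identityˡ _))

*-inv : ∀ x → x ≢ 0ℚ → x * inv x ≡ 1ℚ
*-inv x x≢0 with x ≟ 0ℚ
... | yes x≡0 = ⊥-elim (x≢0 x≡0)
... | no  _   = trans (cong (x *_) (*-identityˡ _)) (*-inverseʳ x {{ℚ.≢-nonZero x≢0}})

inv-unique : ∀ x y → x * y ≡ 1ℚ → inv x ≡ y
inv-unique x y xy≡1 = begin
  inv x              ≡⟨ sym (*-identityʳ (inv x)) ⟩
  inv x * 1ℚ         ≡⟨ cong (inv x *_) (sym xy≡1) ⟩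
  inv x * (x * y)    ≡⟨ sym (*-assoc (inv x) x y) ⟩
  (inv x * x) * y    ≡⟨ cong (_* y) (trans (*-comm (inv x) x) (*-inv x x≢0)) ⟩
  1ℚ * y             ≡⟨ *-identityˡ y ⟩
  y                  ∎
  where
  open ≡-Reasoning
  x≢0 : x ≢ 0ℚ
  x≢0 refl = 1≢0 (trans (sym xy≡1) (*-zeroˡ y))

inv-involutive : ∀ x → inv (inv x) ≡ x
inv-involutive x = by-cases (x ≟ 0ℚ)
  where
  by-cases : Dec (x ≡ 0ℚ) → inv (inv x) ≡ x
  by-cases (yes refl) = refl
  by-cases (no x≢0)   = inv-unique (inv x) x (trans (*-comm (inv x) x) (*-inv x x≢0))

inv-distrib-* : ∀ x y → inv (x * y) ≡ inv x * inv y
inv-distrib-* x y = by-cases (x ≟ 0ℚ) (y ≟ 0ℚ)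
  where
  open ℚ-Solver.+-*-Solver using (solve; _:*_; _:=_)
  interchange : ∀ a b c d → (a * b) * (c * d) ≡ (a * c) * (b * d)
  interchange = solve 4 (λ a b c d → (a :* b) :* (c :* d) := (a :* c) :* (b :* d)) refl
  open ≡-Reasoning
  by-cases : Dec (x ≡ 0ℚ) → Dec (y ≡ 0ℚ) → inv (x * y) ≡ inv x * inv y
  by-cases (yes refl) _          = trans (cong inv (*-zeroˡ y)) (sym (*-zeroˡ (inv y)))
  by-cases (no _)     (yes refl) = trans (cong inv (*-zeroʳ x)) (sym (*-zeroʳ (inv x)))
  by-cases (no x≢0)   (no y≢0)   = inv-unique (x * y) (inv x * inv y) (begin
    (x * y) * (inv x * inv y)  ≡⟨ interchange x y (inv x) (inv y) ⟩
    (x * inv x) * (y * inv y)  ≡⟨ cong₂ _*_ (*-inv x x≢0) (*-inv y y≢0) ⟩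
    1ℚ                         ∎)

div-self : ∀ x → x ≢ 0ℚ → div x x ≡ 1ℚ
div-self x x≢0 = trans (div≡*inv x x) (*-inv x x≢0)

module _ {q : ℚ} (0≤q : 0ℚ ≤ℚ q) (q<1 : q <ℚ 1ℚ) where

  private instance
    q-nonNeg : ℚ.NonNegative q
    q-nonNeg = ℚ.nonNegative 0≤q

  pow-≤1 : ∀ i → pow q i ≤ℚ 1ℚ
  pow-≤1 zero    = ≤-refl
  pow-≤1 (suc i) = ≤-trans (*-monoˡ-≤-nonNeg q (pow-≤1 i)) (≤-trans (≤-reflexive (*-identityʳ q)) (<⇒≤ q<1))

  pow-suc-<1 : ∀ i → pow q (suc i) <ℚ 1ℚ
  pow-suc-<1 i = ≤-<-trans (*-monoˡ-≤-nonNeg q (pow-≤1 i)) (subst (_<ℚ 1ℚ) (sym (*-identityʳ q)) q<1)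

  qfact-positive : ∀ a → Positive (qfact q a)
  qfact-positive zero    = _
  qfact-positive (suc a) =
    pos*pos⇒pos (qfact q a) {{qfact-positive a}} (1ℚ - pow q (suc a)) {{ℚ.positive 0<1-q^[1+a]}}
    where
    0<1-q^[1+a] : 0ℚ <ℚ 1ℚ - pow q (suc a)
    0<1-q^[1+a] = subst (_<ℚ 1ℚ - pow q (suc a)) (+-inverseʳ (pow q (suc a)))
                        (+-monoˡ-< (ℚ.- pow q (suc a)) (pow-suc-<1 a))

  qfact≢0 : ∀ a → qfact q a ≢ 0ℚ
  qfact≢0 a qfact≡0 = <⇒≢ (positive⁻¹ (qfact q a) {{qfact-positive a}}) (sym qfact≡0)

range-bounds : ∀ lo hi → All (λ l → lo ≤ l × l ≤ hi) (range lo hi)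
range-bounds lo hi = All.map⁺ (All.map (λ {i} i<len → ℕ.m≤m+n lo i , ℕ.≤-pred (+-<-∸ lo i<len))
                                       (All.all-upTo (suc hi ∸ lo)))
  where
  +-<-∸ : ∀ lo {i m} → i < m ∸ lo → lo + i < m
  +-<-∸ zero                 i<m   = i<m
  +-<-∸ (suc lo) {m = suc m} i<m∸lo = s≤s (+-<-∸ lo i<m∸lo)

InHypSupport : ℕ → ℕ∞ → ℕ → ℕ → Set
InHypSupport m1 m2 k x = x ≤ m1 ⊓ k × (∀ m2′ → m2 ≡ fin m2′ → k ∸ m2′ ≤ x)

qHyp-support : ∀ q m1 m2 k → Supported (InHypSupport m1 m2 k) (qHyp q m1 m2 k)
qHyp-support q m1 (fin m2) k = All.map⁺ (All.map (λ { (lo≤x , x≤hi) → x≤hi , λ { _ refl → lo≤x } })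
                                                 (range-bounds (k ∸ m2) (m1 ⊓ k)))
qHyp-support q m1 ∞        k = All.map⁺ (All.map (λ { (_ , x≤hi) → x≤hi , λ _ () })
                                                 (range-bounds 0 (m1 ⊓ k)))

module _ (q : ℚ) where

  private
    F : ℕ → ℚ
    F = qfact q

  qHyp-∞-sym : ∀ m1 k → qHyp q m1 ∞ k ≡ qHyp q k ∞ m1
  qHyp-∞-sym m1 k rewrite ℕ.⊓-comm m1 k =
    map-cong (λ l → cong₂ (λ a b → div a b , l) (numerator l) (denominator l)) (range 0 (k ⊓ m1))
    where
    open ℚ-Solver.+-*-Solver using (solve; _:*_; _:=_)
    swap₂₃ : ∀ a b c → a * b * c ≡ a * c * b
    swap₂₃ = solve 3 (λ a b c → a :* b :* c := a :* c :* b) refl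
    numerator : ∀ l → pow q ((m1 ∸ l) ℕ.* (k ∸ l)) * F m1 * F k ≡ pow q ((k ∸ l) ℕ.* (m1 ∸ l)) * F k * F m1
    numerator l rewrite ℕ.*-comm (m1 ∸ l) (k ∸ l) = swap₂₃ (pow q ((k ∸ l) ℕ.* (m1 ∸ l))) (F m1) (F k)
    denominator : ∀ l → F l * F (m1 ∸ l) * F (k ∸ l) ≡ F l * F (k ∸ l) * F (m1 ∸ l)
    denominator l = swap₂₃ (F l) (F (m1 ∸ l)) (F (k ∸ l))

  qbinom≡ : ∀ a b → qbinom q a b ≡ F a * (inv (F b) * inv (F (a ∸ b)))
  qbinom≡ a b = trans (div≡*inv (F a) (F b * F (a ∸ b))) (cong (F a *_) (inv-distrib-* (F b) (F (a ∸ b))))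

  inv-qbinom : ∀ a b → inv (qbinom q a b) ≡ inv (F a) * (F b * F (a ∸ b))
  inv-qbinom a b = begin
    inv (qbinom q a b)                              ≡⟨ cong inv (qbinom≡ a b) ⟩
    inv (F a * (inv (F b) * inv (F (a ∸ b))))       ≡⟨ inv-distrib-* (F a) _ ⟩
    inv (F a) * inv (inv (F b) * inv (F (a ∸ b)))   ≡⟨ cong (inv (F a) *_) (inv-distrib-* (inv (F b)) _) ⟩
    inv (F a) * (inv (inv (F b)) * inv (inv (F (a ∸ b))))
      ≡⟨ cong (inv (F a) *_) (cong₂ _*_ (inv-involutive (F b)) (inv-involutive (F (a ∸ b)))) ⟩
    inv (F a) * (F b * F (a ∸ b))                   ∎
    where open ≡-Reasoning

  hypWeight : ℕ → ℕ → ℕ → ℕ → ℚ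
  hypWeight N a b l =
    div (pow q ((a ∸ l) ℕ.* (b ∸ l)) * qbinom q a l * qbinom q (N ∸ a) (b ∸ l)) (qbinom q (a + (N ∸ a)) b)

  hypWeight≡ : ∀ N a b l → a ≤ N → hypWeight N a b l ≡
    pow q ((a ∸ l) ℕ.* (b ∸ l)) * (F a * (inv (F l) * inv (F (a ∸ l))))
      * (F (N ∸ a) * (inv (F (b ∸ l)) * inv (F ((N ∸ a) ∸ (b ∸ l))))) * (inv (F N) * (F b * F (N ∸ b)))
  hypWeight≡ N a b l a≤N rewrite ℕ.m+[n∸m]≡n a≤N =
    trans (div≡*inv _ (qbinom q N b))
          (cong₂ _*_ (cong₂ _*_ (cong (pow q ((a ∸ l) ℕ.* (b ∸ l)) *_) (qbinom≡ a l)) (qbinom≡ (N ∸ a) (b ∸ l)))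
                     (inv-qbinom N b))

  [N∸a]∸[b∸l]≡[N∸b]∸[a∸l] : ∀ N a b l → l ≤ a → l ≤ b → (N ∸ a) ∸ (b ∸ l) ≡ (N ∸ b) ∸ (a ∸ l)
  [N∸a]∸[b∸l]≡[N∸b]∸[a∸l] N a b l l≤a l≤b = begin
    (N ∸ a) ∸ (b ∸ l)  ≡⟨ ℕ.∸-+-assoc N a (b ∸ l) ⟩
    N ∸ (a + (b ∸ l))  ≡⟨ cong (N ∸_) (sym (ℕ.+-∸-assoc a l≤b)) ⟩
    N ∸ ((a + b) ∸ l)  ≡⟨ cong (λ z → N ∸ (z ∸ l)) (ℕ.+-comm a b) ⟩
    N ∸ ((b + a) ∸ l)  ≡⟨ cong (N ∸_) (ℕ.+-∸-assoc b l≤a) ⟩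
    N ∸ (b + (a ∸ l))  ≡⟨ sym (ℕ.∸-+-assoc N b (a ∸ l)) ⟩
    (N ∸ b) ∸ (a ∸ l)  ∎
    where open ≡-Reasoning

  hypWeight-sym : ∀ N a b l → a ≤ N → b ≤ N → l ≤ a → l ≤ b → hypWeight N a b l ≡ hypWeight N b a l
  hypWeight-sym N a b l a≤N b≤N l≤a l≤b
    rewrite hypWeight≡ N a b l a≤N | hypWeight≡ N b a l b≤N
          | [N∸a]∸[b∸l]≡[N∸b]∸[a∸l] N a b l l≤a l≤b | ℕ.*-comm (a ∸ l) (b ∸ l) =
    regroup (pow q ((b ∸ l) ℕ.* (a ∸ l))) (F a) (F b) (inv (F l)) (inv (F (a ∸ l))) (inv (F (b ∸ l)))
            (F (N ∸ a)) (F (N ∸ b)) (inv (F ((N ∸ b) ∸ (a ∸ l)))) (inv (F N))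
    where
    open ℚ-Solver.+-*-Solver using (solve; _:*_; _:=_)
    regroup : ∀ P fa fb il ial ibl fna fnb iR iN →
      P * (fa * (il * ial)) * (fna * (ibl * iR)) * (iN * (fb * fnb))
        ≡ P * (fb * (il * ibl)) * (fnb * (ial * iR)) * (iN * (fa * fna))
    regroup = solve 10 (λ P fa fb il ial ibl fna fnb iR iN →
      P :* (fa :* (il :* ial)) :* (fna :* (ibl :* iR)) :* (iN :* (fb :* fnb))
        := P :* (fb :* (il :* ibl)) :* (fnb :* (ial :* iR)) :* (iN :* (fa :* fna))) refl

  b∸[N∸a]≡a∸[N∸b] : ∀ N a b → a ≤ N → b ≤ N → b ∸ (N ∸ a) ≡ a ∸ (N ∸ b)
  b∸[N∸a]≡a∸[N∸b] N a b a≤N b≤N = begin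
    b ∸ (N ∸ a)              ≡⟨ sym (ℕ.[m+n]∸[m+o]≡n∸o a b (N ∸ a)) ⟩
    (a + b) ∸ (a + (N ∸ a))  ≡⟨ cong₂ _∸_ (ℕ.+-comm a b) (ℕ.m+[n∸m]≡n a≤N) ⟩
    (b + a) ∸ N              ≡⟨ cong ((b + a) ∸_) (sym (ℕ.m+[n∸m]≡n b≤N)) ⟩
    (b + a) ∸ (b + (N ∸ b))  ≡⟨ ℕ.[m+n]∸[m+o]≡n∸o b a (N ∸ b) ⟩
    a ∸ (N ∸ b)              ∎
    where open ≡-Reasoning

  qHyp-fin-sym : ∀ N a b → a ≤ N → b ≤ N → qHyp q a (fin (N ∸ a)) b ≡ qHyp q b (fin (N ∸ b)) a
  qHyp-fin-sym N a b a≤N b≤N rewrite b∸[N∸a]≡a∸[N∸b] N a b a≤N b≤N | ℕ.⊓-comm a b =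
    map-cong-local (All.map (λ { {l} (_ , l≤b⊓a) →
                                   cong (_, l) (hypWeight-sym N a b l a≤N b≤N (ℕ.≤-trans l≤b⊓a (ℕ.m⊓n≤n b a))
                                                                              (ℕ.≤-trans l≤b⊓a (ℕ.m⊓n≤m b a))) })
                            (range-bounds (a ∸ (N ∸ b)) (b ⊓ a)))

module _ {q : ℚ} (0≤q : 0ℚ ≤ℚ q) (q<1 : q <ℚ 1ℚ) where

  qbinom-zero : ∀ a → qbinom q a 0 ≡ 1ℚ
  qbinom-zero a = trans (cong (div (qfact q a)) (*-identityˡ (qfact q a))) (div-self (qfact q a) (qfact≢0 0≤q q<1 a))

  𝔼-qHyp-zero : ∀ m1 m2 (f : ℕ → ℚ) → 𝔼 (qHyp q m1 m2 0) f ≡ f 0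
  𝔼-qHyp-zero m1 (fin m2) f rewrite ℕ.0∸n≡0 m2 | ℕ.⊓-zeroʳ m1 | ℕ.*-zeroʳ m1
                             | qbinom-zero m1 | qbinom-zero m2 | qbinom-zero (m1 + m2) =
    trans (+-identityʳ _) (*-identityˡ (f 0))
  𝔼-qHyp-zero m1 ∞        f rewrite ℕ.⊓-zeroʳ m1 | ℕ.*-zeroʳ m1 =
    trans (+-identityʳ _) (trans (cong (_* f 0) weight≡1) (*-identityˡ (f 0)))
    where
    1*x*1≡x : ∀ x → 1ℚ * x * 1ℚ ≡ x
    1*x*1≡x x = trans (*-identityʳ _) (*-identityˡ x)
    weight≡1 : div (1ℚ * qfact q m1 * 1ℚ) (1ℚ * qfact q m1 * 1ℚ) ≡ 1ℚ
    weight≡1 = div-self _ (λ eq → qfact≢0 0≤q q<1 m1 (trans (sym (1*x*1≡x _)) eq))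

cong₃ : ∀ {A B C D : Set} (f : A → B → C → D) {a a′ b b′ c c′} → a ≡ a′ → b ≡ b′ → c ≡ c′ → f a b c ≡ f a′ b′ c′
cong₃ f refl refl refl = refl

Seq : Set
Seq = ℕ → ℕ

≡ᵇ-refl : ∀ k → (k ≡ᵇ k) ≡ true
≡ᵇ-refl zero    = refl
≡ᵇ-refl (suc k) = ≡ᵇ-refl k

≢⇒≡ᵇ≡false : ∀ {i k} → i ≢ k → (i ≡ᵇ k) ≡ false
≢⇒≡ᵇ≡false {zero}  {zero}  i≢k = ⊥-elim (i≢k refl)
≢⇒≡ᵇ≡false {zero}  {suc k} i≢k = refl
≢⇒≡ᵇ≡false {suc i} {zero}  i≢k = refl
≢⇒≡ᵇ≡false {suc i} {suc k} i≢k = ≢⇒≡ᵇ≡false (i≢k ∘ cong suc)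

infixl 5 _[_]≔_
_[_]≔_ : Seq → ℕ → ℕ → Seq
(s [ k ]≔ v) i = if i ≡ᵇ k then v else s i

[]≔-same : ∀ s k v → (s [ k ]≔ v) k ≡ v
[]≔-same s k v rewrite ≡ᵇ-refl k = refl

[]≔-other : ∀ s {k} v {i} → i ≢ k → (s [ k ]≔ v) i ≡ s i
[]≔-other s v i≢k rewrite ≢⇒≡ᵇ≡false i≢k = refl

∸1< : ∀ {x} → 1 ≤ x → x ∸ 1 < x
∸1< {suc x} _ = ℕ.n<1+n x

VanishesFrom : ℕ → Seq → Set
VanishesFrom k s = ∀ i → k ≤ i → s i ≡ 0

-- μ interlaces ρ, as level j interlaces level j + 1 of a GT pattern
infix 4 _≺_
_≺_ : Seq → Seq → Set
μ ≺ ρ = ∀ i → 1 ≤ i → μ i ≤ ρ i × ρ (suc i) ≤ μ i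

-- The second parameter λ^{j-1}_{k-1} - λ̃^{j-1}_k of the k-th draw, with μ = λ^{j-1},
-- κ = λ̃^{j-1}, and λ^{j-1}_0 = ∞.
slack : Seq → Seq → ℕ → ℕ∞
slack μ κ zero          = ∞
slack μ κ (suc zero)    = ∞
slack μ κ (suc (suc k)) = fin (μ (suc k) ∸ κ (suc (suc k)))

-- One level j of an insertion, from position k on with r draws left: μ = λ^{j-1}, κ = λ̃^{j-1},
-- ν = λ^j, c = a^j_k, and acc the new level built so far.
insertLevel : ℚ → (μ κ ν : Seq) → (r k c : ℕ) → Seq → Dist Seq
insertLevel q μ κ ν zero    k c acc = ret (acc [ k ]≔ ν k + c)
insertLevel q μ κ ν (suc r) k c acc =
  bind (qHyp q (κ k ∸ μ k) (slack μ κ k) (ν k ∸ μ k))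
       (λ x → insertLevel q μ κ ν r (suc k) x (acc [ k ]≔ (c + ν k + κ k) ∸ (μ k + x)))

cell : ℚ → (a j : ℕ) → (μ κ ν : Seq) → Dist Seq
cell q a j μ κ ν = insertLevel q μ κ ν (j ∸ 1) 1 a ν

slack-cong : ∀ {μ μ′ κ κ′} → μ ≗ μ′ → κ ≗ κ′ → ∀ k → slack μ κ k ≡ slack μ′ κ′ k
slack-cong μ≗ κ≗ zero          = refl
slack-cong μ≗ κ≗ (suc zero)    = refl
slack-cong μ≗ κ≗ (suc (suc k)) = cong₂ (λ a b → fin (a ∸ b)) (μ≗ (suc k)) (κ≗ (suc (suc k)))

𝔼-insertLevel-cong : ∀ q {μ κ ν μ′ κ′ ν′} → μ ≗ μ′ → κ ≗ κ′ → ν ≗ ν′ → ∀ r k c {acc acc′} → acc ≗ acc′ →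
  {H H′ : Seq → ℚ} → (∀ {s s′} → s ≗ s′ → H s ≡ H′ s′) →
  𝔼 (insertLevel q μ κ ν r k c acc) H ≡ 𝔼 (insertLevel q μ′ κ′ ν′ r k c acc′) H′
𝔼-insertLevel-cong q {ν = ν} {ν′ = ν′} μ≗ κ≗ ν≗ zero k c {acc} {acc′} acc≗ {H} {H′} H≡ =
  trans (𝔼-ret _ H) (trans (H≡ updated) (sym (𝔼-ret _ H′)))
  where
  updated : acc [ k ]≔ ν k + c ≗ acc′ [ k ]≔ ν′ k + c
  updated i with i ≡ᵇ k
  ... | true  = cong (_+ c) (ν≗ k)
  ... | false = acc≗ i
𝔼-insertLevel-cong q {μ} {κ} {ν} {μ′} {κ′} {ν′} μ≗ κ≗ ν≗ (suc r) k c {acc} {acc′} acc≗ {H} {H′} H≡ =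
  begin
    𝔼 (bind (qHyp q (κ k ∸ μ k) (slack μ κ k) (ν k ∸ μ k)) _) H
      ≡⟨ 𝔼-bind (qHyp q (κ k ∸ μ k) (slack μ κ k) (ν k ∸ μ k)) _ H ⟩
    𝔼 (qHyp q (κ k ∸ μ k) (slack μ κ k) (ν k ∸ μ k)) _
      ≡⟨ cong₂ 𝔼 (cong₃ (qHyp q) (cong₂ _∸_ (κ≗ k) (μ≗ k)) (slack-cong μ≗ κ≗ k) (cong₂ _∸_ (ν≗ k) (μ≗ k))) refl ⟩
    𝔼 (qHyp q (κ′ k ∸ μ′ k) (slack μ′ κ′ k) (ν′ k ∸ μ′ k)) _
      ≡⟨ 𝔼-cong (qHyp q (κ′ k ∸ μ′ k) (slack μ′ κ′ k) (ν′ k ∸ μ′ k))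
                (λ x → 𝔼-insertLevel-cong q μ≗ κ≗ ν≗ r (suc k) x (updated x) H≡) ⟩
    𝔼 (qHyp q (κ′ k ∸ μ′ k) (slack μ′ κ′ k) (ν′ k ∸ μ′ k)) _
      ≡⟨ sym (𝔼-bind (qHyp q (κ′ k ∸ μ′ k) (slack μ′ κ′ k) (ν′ k ∸ μ′ k)) _ H′) ⟩
    𝔼 (bind (qHyp q (κ′ k ∸ μ′ k) (slack μ′ κ′ k) (ν′ k ∸ μ′ k)) _) H′
  ∎
  where
  open ≡-Reasoning
  updated : ∀ x → acc [ k ]≔ (c + ν k + κ k) ∸ (μ k + x) ≗ acc′ [ k ]≔ (c + ν′ k + κ′ k) ∸ (μ′ k + x)
  updated x i with i ≡ᵇ k
  ... | true  = cong₃ (λ a b d → (c + a + b) ∸ (d + x)) (ν≗ k) (κ≗ k) (μ≗ k)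
  ... | false = acc≗ i

c∸b≡[c∸a]∸[b∸a] : ∀ {a b c} → a ≤ b → c ∸ b ≡ (c ∸ a) ∸ (b ∸ a)
c∸b≡[c∸a]∸[b∸a] {a} {b} {c} a≤b = sym (trans (ℕ.∸-+-assoc c a (b ∸ a)) (cong (c ∸_) (ℕ.m+[n∸m]≡n a≤b)))

-- With N = μ_{k-1} - μ_k the k-th draw is qHyp(X_k - μ_k, N - (X_k - μ_k), Y_k - μ_k).
qHyp-draw-sym : ∀ q μ X Y k → μ ≺ X → μ ≺ Y → 1 ≤ k →
  qHyp q (X k ∸ μ k) (slack μ X k) (Y k ∸ μ k) ≡ qHyp q (Y k ∸ μ k) (slack μ Y k) (X k ∸ μ k)
qHyp-draw-sym q μ X Y (suc zero)    μ≺X μ≺Y _ = qHyp-∞-sym q (X 1 ∸ μ 1) (Y 1 ∸ μ 1)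
qHyp-draw-sym q μ X Y (suc (suc k)) μ≺X μ≺Y _ = begin
  qHyp q (X k₂ ∸ μ k₂) (fin (μ k₁ ∸ X k₂)) (Y k₂ ∸ μ k₂)
    ≡⟨ cong (λ z → qHyp q (X k₂ ∸ μ k₂) (fin z) (Y k₂ ∸ μ k₂)) (c∸b≡[c∸a]∸[b∸a] μ≤X) ⟩
  qHyp q (X k₂ ∸ μ k₂) (fin (N ∸ (X k₂ ∸ μ k₂))) (Y k₂ ∸ μ k₂)
    ≡⟨ qHyp-fin-sym q N (X k₂ ∸ μ k₂) (Y k₂ ∸ μ k₂) (ℕ.∸-monoˡ-≤ (μ k₂) X≤μ) (ℕ.∸-monoˡ-≤ (μ k₂) Y≤μ) ⟩
  qHyp q (Y k₂ ∸ μ k₂) (fin (N ∸ (Y k₂ ∸ μ k₂))) (X k₂ ∸ μ k₂)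
    ≡⟨ cong (λ z → qHyp q (Y k₂ ∸ μ k₂) (fin z) (X k₂ ∸ μ k₂)) (sym (c∸b≡[c∸a]∸[b∸a] μ≤Y)) ⟩
  qHyp q (Y k₂ ∸ μ k₂) (fin (μ k₁ ∸ Y k₂)) (X k₂ ∸ μ k₂)
  ∎
  where
  open ≡-Reasoning
  k₁ k₂ N : ℕ
  k₁ = suc k
  k₂ = suc (suc k)
  N = μ k₁ ∸ μ k₂
  μ≤X : μ k₂ ≤ X k₂
  μ≤X = proj₁ (μ≺X k₂ (s≤s z≤n))
  μ≤Y : μ k₂ ≤ Y k₂
  μ≤Y = proj₁ (μ≺Y k₂ (s≤s z≤n))
  X≤μ : X k₂ ≤ μ k₁
  X≤μ = proj₂ (μ≺X k₁ (s≤s z≤n))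
  Y≤μ : Y k₂ ≤ μ k₁
  Y≤μ = proj₂ (μ≺Y k₁ (s≤s z≤n))

lastStep≗ : ∀ {κ ν k c acc} → VanishesFrom k ν → VanishesFrom k κ → (∀ i → k < i → acc i ≡ ν i) →
  (T : Seq) → (∀ i → i < k → T i ≡ acc i) → T k ≡ c + κ k → (∀ i → k < i → T i ≡ κ i) → acc [ k ]≔ ν k + c ≗ T
lastStep≗ {κ} {ν} {k} {c} {acc} ν↓ κ↓ acc≡ν T T<k T≡ T>k i with ℕ.<-cmp i k
... | tri< i<k _ _ = trans ([]≔-other acc _ (ℕ.<⇒≢ i<k)) (sym (T<k i i<k))
... | tri≈ _ refl _ = begin
  (acc [ i ]≔ ν i + c) i  ≡⟨ []≔-same acc i _ ⟩
  ν i + c                ≡⟨ cong (_+ c) (ν↓ i ℕ.≤-refl) ⟩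
  c                      ≡⟨ sym (trans (cong (c +_) (κ↓ i ℕ.≤-refl)) (ℕ.+-identityʳ c)) ⟩
  c + κ i                ≡⟨ sym T≡ ⟩
  T i                    ∎
  where open ≡-Reasoning
... | tri> _ _ k<i = begin
  (acc [ k ]≔ ν k + c) i  ≡⟨ []≔-other acc _ (ℕ.>⇒≢ k<i) ⟩
  acc i                  ≡⟨ acc≡ν i k<i ⟩
  ν i                    ≡⟨ ν↓ i (ℕ.<⇒≤ k<i) ⟩
  0                      ≡⟨ sym (κ↓ i (ℕ.<⇒≤ k<i)) ⟩
  κ i                    ≡⟨ sym (T>k i k<i) ⟩
  T i                    ∎
  where open ≡-Reasoning

module _ {q : ℚ} (0≤q : 0ℚ ≤ℚ q) (q<1 : q <ℚ 1ℚ) where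

  -- Once ν has vanished every draw is qHyp(_, _, 0), hence 0, and the rest of κ is copied.
  𝔼-insertLevel-exhausted : ∀ μ κ ν r k c acc (H : Seq → ℚ) → H Preserves _≗_ ⟶ _≡_ →
    VanishesFrom k ν → VanishesFrom k μ → VanishesFrom (k + r) κ → (∀ i → k < i → acc i ≡ ν i) →
    (T : Seq) → (∀ i → i < k → T i ≡ acc i) → T k ≡ c + κ k → (∀ i → k < i → T i ≡ κ i) →
    𝔼 (insertLevel q μ κ ν r k c acc) H ≡ H T
  𝔼-insertLevel-exhausted μ κ ν zero k c acc H H-resp ν↓ μ↓ κ↓ acc≡ν T T<k T≡ T>k =
    trans (𝔼-ret _ H) (H-resp (lastStep≗ ν↓ (λ i k≤i → κ↓ i (ℕ.≤-trans (ℕ.≤-reflexive (ℕ.+-identityʳ k)) k≤i))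
                                       acc≡ν T T<k T≡ T>k))
  𝔼-insertLevel-exhausted μ κ ν (suc r) k c acc H H-resp ν↓ μ↓ κ↓ acc≡ν T T<k T≡ T>k = begin
    𝔼 (insertLevel q μ κ ν (suc r) k c acc) H
      ≡⟨ 𝔼-bind (qHyp q (κ k ∸ μ k) (slack μ κ k) (ν k ∸ μ k)) _ H ⟩
    𝔼 (qHyp q (κ k ∸ μ k) (slack μ κ k) (ν k ∸ μ k)) continue
      ≡⟨ cong (λ z → 𝔼 (qHyp q (κ k ∸ μ k) (slack μ κ k) z) continue) ν∸μ≡0 ⟩
    𝔼 (qHyp q (κ k ∸ μ k) (slack μ κ k) 0) continue
      ≡⟨ 𝔼-qHyp-zero 0≤q q<1 (κ k ∸ μ k) (slack μ κ k) continue ⟩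
    continue 0
      ≡⟨ 𝔼-insertLevel-exhausted μ κ ν r (suc k) 0 acc′ H H-resp
           (λ i k<i → ν↓ i (ℕ.<⇒≤ k<i)) (λ i k<i → μ↓ i (ℕ.<⇒≤ k<i))
           (λ i h → κ↓ i (ℕ.≤-trans (ℕ.≤-reflexive (ℕ.+-suc k r)) h))
           (λ i h → trans ([]≔-other acc _ (ℕ.>⇒≢ (ℕ.<-trans (ℕ.n<1+n k) h))) (acc≡ν i (ℕ.<-trans (ℕ.n<1+n k) h)))
           T T<1+k (T>k (suc k) (ℕ.n<1+n k)) (λ i h → T>k i (ℕ.<-trans (ℕ.n<1+n k) h)) ⟩
    H T
    ∎
    where
    open ≡-Reasoning
    acc′ : Seq
    acc′ = acc [ k ]≔ (c + ν k + κ k) ∸ (μ k + 0)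
    continue : ℕ → ℚ
    continue x = 𝔼 (insertLevel q μ κ ν r (suc k) x (acc [ k ]≔ (c + ν k + κ k) ∸ (μ k + x))) H
    ν∸μ≡0 : ν k ∸ μ k ≡ 0
    ν∸μ≡0 rewrite ν↓ k ℕ.≤-refl = ℕ.0∸n≡0 (μ k)
    T<1+k : ∀ i → i < suc k → T i ≡ acc′ i
    T<1+k i i<1+k with ℕ.<-cmp i k
    ... | tri< i<k _ _ = trans (T<k i i<k) (sym ([]≔-other acc _ (ℕ.<⇒≢ i<k)))
    ... | tri≈ _ refl _ rewrite []≔-same acc i ((c + ν i + κ i) ∸ (μ i + 0)) | ν↓ i ℕ.≤-refl | μ↓ i ℕ.≤-refl
                               | ℕ.+-identityʳ c = T≡
    ... | tri> _ _ k<i = ⊥-elim (ℕ.<⇒≱ k<i (ℕ.≤-pred i<1+k))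

  𝔼-insertLevel-swap : ∀ μ X Y → μ ≺ X → μ ≺ Y → ∀ r r′ k c acc acc′ (H : Seq → ℚ) → H Preserves _≗_ ⟶ _≡_ →
    1 ≤ k → r ≤ r′ → VanishesFrom (k + r) X → VanishesFrom (k + r) μ → VanishesFrom (k + r′) Y →
    (∀ i → i < k → acc i ≡ acc′ i) → (∀ i → k < i → acc i ≡ Y i) → (∀ i → k < i → acc′ i ≡ X i) →
    𝔼 (insertLevel q μ X Y r k c acc) H ≡ 𝔼 (insertLevel q μ Y X r′ k c acc′) H
  𝔼-insertLevel-swap μ X Y μ≺X μ≺Y zero r′ k c acc acc′ H H-resp _ _ X↓ μ↓ Y↓ acc≡ acc≡Y acc′≡X =
    trans (𝔼-ret _ H) (sym (𝔼-insertLevel-exhausted μ Y X r′ k c acc′ H H-resp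
      (λ i h → X↓ i (ℕ.≤-trans (ℕ.≤-reflexive (ℕ.+-identityʳ k)) h))
      (λ i h → μ↓ i (ℕ.≤-trans (ℕ.≤-reflexive (ℕ.+-identityʳ k)) h)) Y↓ acc′≡X
      (acc [ k ]≔ Y k + c)
      (λ i i<k → trans ([]≔-other acc _ (ℕ.<⇒≢ i<k)) (acc≡ i i<k))
      (trans ([]≔-same acc k _) (ℕ.+-comm (Y k) c))
      (λ i k<i → trans ([]≔-other acc _ (ℕ.>⇒≢ k<i)) (acc≡Y i k<i))))
  𝔼-insertLevel-swap μ X Y μ≺X μ≺Y (suc r) zero k c acc acc′ H H-resp _ () X↓ μ↓ Y↓ acc≡ acc≡Y acc′≡X
  𝔼-insertLevel-swap μ X Y μ≺X μ≺Y (suc r) (suc r′) k c acc acc′ H H-resp 1≤k 1+r≤1+r′ X↓ μ↓ Y↓ acc≡ acc≡Y acc′≡X =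
    begin
      𝔼 (bind (qHyp q (X k ∸ μ k) (slack μ X k) (Y k ∸ μ k)) _) H
        ≡⟨ 𝔼-bind (qHyp q (X k ∸ μ k) (slack μ X k) (Y k ∸ μ k)) _ H ⟩
      𝔼 (qHyp q (X k ∸ μ k) (slack μ X k) (Y k ∸ μ k)) _
        ≡⟨ cong₂ 𝔼 (qHyp-draw-sym q μ X Y k μ≺X μ≺Y 1≤k) refl ⟩
      𝔼 (qHyp q (Y k ∸ μ k) (slack μ Y k) (X k ∸ μ k)) _
        ≡⟨ 𝔼-cong (qHyp q (Y k ∸ μ k) (slack μ Y k) (X k ∸ μ k)) (λ x →
             𝔼-insertLevel-swap μ X Y μ≺X μ≺Y r r′ (suc k) x _ _ H H-resp (s≤s z≤n) (ℕ.≤-pred 1+r≤1+r′)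
               (λ i h → X↓ i (ℕ.≤-trans (ℕ.≤-reflexive (ℕ.+-suc k r)) h))
               (λ i h → μ↓ i (ℕ.≤-trans (ℕ.≤-reflexive (ℕ.+-suc k r)) h))
               (λ i h → Y↓ i (ℕ.≤-trans (ℕ.≤-reflexive (ℕ.+-suc k r′)) h))
               (agree-below x) (above acc acc≡Y) (above acc′ acc′≡X)) ⟩
      𝔼 (qHyp q (Y k ∸ μ k) (slack μ Y k) (X k ∸ μ k)) _
        ≡⟨ sym (𝔼-bind (qHyp q (Y k ∸ μ k) (slack μ Y k) (X k ∸ μ k)) _ H) ⟩
      𝔼 (bind (qHyp q (Y k ∸ μ k) (slack μ Y k) (X k ∸ μ k)) _) H
    ∎
    where
    open ≡-Reasoning
    above : ∀ a {Z : Seq} {v} → (∀ i → k < i → a i ≡ Z i) → ∀ i → suc k < i → (a [ k ]≔ v) i ≡ Z i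
    above a a≡Z i 1+k<i = trans ([]≔-other a _ (ℕ.>⇒≢ (ℕ.<-trans (ℕ.n<1+n k) 1+k<i))) (a≡Z i (ℕ.<-trans (ℕ.n<1+n k) 1+k<i))
    agree-below : ∀ x i → i < suc k →
      (acc [ k ]≔ (c + Y k + X k) ∸ (μ k + x)) i ≡ (acc′ [ k ]≔ (c + X k + Y k) ∸ (μ k + x)) i
    agree-below x i i<1+k with ℕ.<-cmp i k
    ... | tri< i<k _ _ = trans ([]≔-other acc _ (ℕ.<⇒≢ i<k)) (trans (acc≡ i i<k) (sym ([]≔-other acc′ _ (ℕ.<⇒≢ i<k))))
    ... | tri≈ _ refl _ = trans ([]≔-same acc i _)
                            (trans (cong (λ z → z ∸ (μ i + x)) (+-xy∙z≈xz∙y c (Y i) (X i))) (sym ([]≔-same acc′ i _)))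
    ... | tri> _ _ k<i = ⊥-elim (ℕ.<⇒≱ k<i (ℕ.≤-pred i<1+k))

  𝔼-cell-swap : ∀ a s s′ μ X Y (H : Seq → ℚ) → H Preserves _≗_ ⟶ _≡_ → 1 ≤ s → s ≤ s′ → μ ≺ X → μ ≺ Y →
    VanishesFrom s X → VanishesFrom s μ → VanishesFrom s′ Y → X 0 ≡ Y 0 →
    𝔼 (cell q a s μ X Y) H ≡ 𝔼 (cell q a s′ μ Y X) H
  𝔼-cell-swap a (suc s) (suc s′) μ X Y H H-resp _ s≤s′ μ≺X μ≺Y X↓ μ↓ Y↓ X0≡Y0 =
    𝔼-insertLevel-swap μ X Y μ≺X μ≺Y s s′ 1 a Y X H H-resp (s≤s z≤n) (ℕ.≤-pred s≤s′) X↓ μ↓ Y↓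
      (λ { zero _ → sym X0≡Y0 ; (suc _) (s≤s ()) }) (λ _ _ → refl) (λ _ _ → refl)

  𝔼-cell-transpose : ∀ a ℓ j μ κ ν (H : Seq → ℚ) → H Preserves _≗_ ⟶ _≡_ → 1 ≤ ℓ → 1 ≤ j → μ ≺ κ → μ ≺ ν →
    VanishesFrom j κ → VanishesFrom ℓ ν → VanishesFrom j μ → VanishesFrom ℓ μ → κ 0 ≡ ν 0 →
    𝔼 (cell q a ℓ μ ν κ) H ≡ 𝔼 (cell q a j μ κ ν) H
  𝔼-cell-transpose a ℓ j μ κ ν H H-resp 1≤ℓ 1≤j μ≺κ μ≺ν κ↓ ν↓ μ↓j μ↓ℓ κ0≡ν0 with ℕ.≤-total j ℓ
  ... | inj₁ j≤ℓ = sym (𝔼-cell-swap a j ℓ μ κ ν H H-resp 1≤j j≤ℓ μ≺κ μ≺ν κ↓ μ↓j ν↓ κ0≡ν0)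
  ... | inj₂ ℓ≤j = 𝔼-cell-swap a ℓ j μ ν κ H H-resp 1≤ℓ ℓ≤j μ≺ν μ≺κ ν↓ μ↓ℓ κ↓ (sym κ0≡ν0)

κ≤newEntry : ∀ c ν κ μ x → μ + x ≤ ν → κ ≤ (c + ν + κ) ∸ (μ + x)
κ≤newEntry c ν κ μ x μ+x≤ν = ℕ.m+n≤o⇒m≤o∸n κ (begin
  κ + (μ + x)  ≤⟨ ℕ.+-monoʳ-≤ κ (ℕ.≤-trans μ+x≤ν (ℕ.m≤n+m ν c)) ⟩
  κ + (c + ν)  ≡⟨ ℕ.+-comm κ (c + ν) ⟩
  c + ν + κ    ∎)
  where open ℕ.≤-Reasoning

ν≤newEntry : ∀ c ν κ μ x → μ + x ≤ κ → ν ≤ (c + ν + κ) ∸ (μ + x)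
ν≤newEntry c ν κ μ x μ+x≤κ = ℕ.m+n≤o⇒m≤o∸n ν (begin
  ν + (μ + x)  ≤⟨ ℕ.+-monoʳ-≤ ν μ+x≤κ ⟩
  ν + κ        ≤⟨ ℕ.m≤n+m (ν + κ) c ⟩
  c + (ν + κ)  ≡⟨ ℕ.+-assoc c ν κ ⟨
  c + ν + κ    ∎)
  where open ℕ.≤-Reasoning

-- μ′ stands for μ_{k-1}; the hypothesis on x is the lower end of the support of the draw.
newEntry≤ : ∀ c ν κ μ μ′ x → κ ≤ μ′ → (ν ∸ μ) ∸ (μ′ ∸ κ) ≤ x → (c + ν + κ) ∸ (μ + x) ≤ c + μ′
newEntry≤ c ν κ μ μ′ x κ≤μ′ lower≤x = ℕ.m≤n+o⇒m∸n≤o (c + ν + κ) (μ + x) (begin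
  c + ν + κ                    ≤⟨ ℕ.+-monoˡ-≤ κ (ℕ.+-monoʳ-≤ c ν≤) ⟩
  c + (μ + (d + x)) + κ        ≡⟨ regroup c μ d x κ ⟩
  (μ + x) + (c + (d + κ))      ≡⟨ cong (λ z → (μ + x) + (c + z)) (ℕ.m∸n+n≡m κ≤μ′) ⟩
  (μ + x) + (c + μ′)           ∎)
  where
  open ℕ.≤-Reasoning
  d : ℕ
  d = μ′ ∸ κ
  ∸≤⇒≤+ : ∀ {a b e} → a ∸ b ≤ e → a ≤ b + e
  ∸≤⇒≤+ {a} {b} a∸b≤e = ℕ.≤-trans (ℕ.m≤n+m∸n a b) (ℕ.+-monoʳ-≤ b a∸b≤e)
  ν≤ : ν ≤ μ + (d + x)
  ν≤ = ∸≤⇒≤+ {b = μ} (∸≤⇒≤+ {b = d} lower≤x)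
  open ℕ-Solver.+-*-Solver using (solve; _:+_; _:=_)
  regroup : ∀ c μ d x κ → c + (μ + (d + x)) + κ ≡ (μ + x) + (c + (d + κ))
  regroup = solve 5 (λ c μ d x κ → c :+ (μ :+ (d :+ x)) :+ κ := (μ :+ x) :+ (c :+ (d :+ κ))) refl

record Fits (a b : ℕ) (s : Seq) : Set where
  field
    at-0 : s 0 ≡ 0
    beyond-a : VanishesFrom (suc a) s
    beyond-b : VanishesFrom (suc b) s

VanishesFrom-pred : ∀ {ℓ s} → 1 ≤ ℓ → VanishesFrom (suc (ℓ ∸ 1)) s → VanishesFrom ℓ s
VanishesFrom-pred {suc ℓ} _ s↓ = s↓

-- The rows around one cell: μ = λ^{j-1}(ℓ-1), κ = λ^{j-1}(ℓ), ν = λ^j(ℓ-1), for ℓ = rows.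
module CellOutput (μ κ ν : Seq) (μ≺κ : μ ≺ κ) (μ≺ν : μ ≺ ν) (rows : ℕ)
                  (μ↓ : VanishesFrom rows μ) (ν↓ : VanishesFrom rows ν) (κ↓ : VanishesFrom (suc rows) κ) where

  record EntryOK (i v : ℕ) : Set where
    field
      κ≤ : κ i ≤ v
      ν≤ : ν i ≤ v
      ≤κ : ∀ i′ → suc i′ ≡ i → 1 ≤ i′ → v ≤ κ i′
      ≤ν : ∀ i′ → suc i′ ≡ i → 1 ≤ i′ → v ≤ ν i′
      vanishes : rows < i → v ≡ 0

  -- c is the value a^j_k carried into position k
  record CarryOK (k c : ℕ) : Set where
    field
      +μ≤κ : ∀ k′ → suc k′ ≡ k → 1 ≤ k′ → c + μ k′ ≤ κ k′
      +μ≤ν : ∀ k′ → suc k′ ≡ k → 1 ≤ k′ → c + μ k′ ≤ ν k′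
      vanishes : rows < k → c ≡ 0

  record OutputOK (k s : ℕ) (acc out : Seq) : Set where
    field
      below : ∀ i → i < k → out i ≡ acc i
      above : ∀ i → s < i → out i ≡ acc i
      entries : ∀ i → k ≤ i → i ≤ s → EntryOK i (out i)

  lastEntryOK : ∀ k c → VanishesFrom k κ → CarryOK k c → EntryOK k (ν k + c)
  lastEntryOK k c κ↓k carry = record
    { κ≤ = subst (_≤ ν k + c) (sym (κ↓k k ℕ.≤-refl)) z≤n
    ; ν≤ = ℕ.m≤m+n (ν k) c
    ; ≤κ = λ { i′ refl 1≤i′ → below (ν≤μ i′ 1≤i′) (+μ≤κ i′ refl 1≤i′) }
    ; ≤ν = λ { i′ refl 1≤i′ → below (ν≤μ i′ 1≤i′) (+μ≤ν i′ refl 1≤i′) }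
    ; vanishes = λ rows<k → cong₂ _+_ (ν↓ k (ℕ.<⇒≤ rows<k)) (vanishes rows<k)
    }
    where
    open CarryOK carry
    ν≤μ : ∀ i′ → 1 ≤ i′ → ν (suc i′) ≤ μ i′
    ν≤μ i′ 1≤i′ = proj₂ (μ≺ν i′ 1≤i′)
    below : ∀ {y μ′ z} → y ≤ μ′ → c + μ′ ≤ z → y + c ≤ z
    below {y} {μ′} {z} y≤μ′ c+μ′≤z = begin
      y + c   ≤⟨ ℕ.+-monoˡ-≤ c y≤μ′ ⟩
      μ′ + c  ≡⟨ ℕ.+-comm μ′ c ⟩
      c + μ′  ≤⟨ c+μ′≤z ⟩
      z       ∎
      where open ℕ.≤-Reasoning

  module _ {k c : ℕ} (1≤k : 1 ≤ k) (carry : CarryOK k c) (x : ℕ)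
           (x∈ : InHypSupport (κ k ∸ μ k) (slack μ κ k) (ν k ∸ μ k) x) where

    private
      v : ℕ
      v = (c + ν k + κ k) ∸ (μ k + x)
      μ≤κ : μ k ≤ κ k
      μ≤κ = proj₁ (μ≺κ k 1≤k)
      μ≤ν : μ k ≤ ν k
      μ≤ν = proj₁ (μ≺ν k 1≤k)
      x≤κ∸μ : x ≤ κ k ∸ μ k
      x≤κ∸μ = ℕ.≤-trans (proj₁ x∈) (ℕ.m⊓n≤m _ _)
      x≤ν∸μ : x ≤ ν k ∸ μ k
      x≤ν∸μ = ℕ.≤-trans (proj₁ x∈) (ℕ.m⊓n≤n _ _)
      x+μ≤κ : x + μ k ≤ κ k
      x+μ≤κ = ℕ.m≤o∸n⇒m+n≤o x μ≤κ x≤κ∸μ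
      x+μ≤ν : x + μ k ≤ ν k
      x+μ≤ν = ℕ.m≤o∸n⇒m+n≤o x μ≤ν x≤ν∸μ

    nextCarryOK : CarryOK (suc k) x
    nextCarryOK = record
      { +μ≤κ = λ { _ refl _ → x+μ≤κ }
      ; +μ≤ν = λ { _ refl _ → x+μ≤ν }
      ; vanishes = λ rows<1+k → ℕ.n≤0⇒n≡0 (ℕ.≤-trans x≤ν∸μ (ℕ.≤-reflexive (ν∸μ≡0 (ℕ.≤-pred rows<1+k))))
      }
      where
      ν∸μ≡0 : rows ≤ k → ν k ∸ μ k ≡ 0
      ν∸μ≡0 rows≤k rewrite ν↓ k rows≤k = ℕ.0∸n≡0 (μ k)

    newEntryOK : EntryOK k v
    newEntryOK = record
      { κ≤ = κ≤newEntry c (ν k) (κ k) (μ k) x (subst (_≤ ν k) (ℕ.+-comm x (μ k)) x+μ≤ν)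
      ; ν≤ = ν≤newEntry c (ν k) (κ k) (μ k) x (subst (_≤ κ k) (ℕ.+-comm x (μ k)) x+μ≤κ)
      ; ≤κ = λ i′ 1+i′≡k 1≤i′ → ℕ.≤-trans (v≤c+μ i′ 1+i′≡k 1≤i′) (+μ≤κ i′ 1+i′≡k 1≤i′)
      ; ≤ν = λ i′ 1+i′≡k 1≤i′ → ℕ.≤-trans (v≤c+μ i′ 1+i′≡k 1≤i′) (+μ≤ν i′ 1+i′≡k 1≤i′)
      ; vanishes = v≡0
      }
      where
      open CarryOK carry
      v≤c+μ : ∀ i′ → suc i′ ≡ k → 1 ≤ i′ → v ≤ c + μ i′
      v≤c+μ (suc i″) refl 1≤i′ =
        newEntry≤ c (ν k) (κ k) (μ k) (μ (suc i″)) x (proj₂ (μ≺κ (suc i″) 1≤i′)) (proj₂ x∈ _ refl)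
      v≡0 : rows < k → v ≡ 0
      v≡0 rows<k rewrite ν↓ k (ℕ.<⇒≤ rows<k) | μ↓ k (ℕ.<⇒≤ rows<k) | κ↓ k rows<k | vanishes rows<k = ℕ.0∸n≡0 x

  outputOK-step : ∀ {k r c acc} → 1 ≤ k → CarryOK k c → ∀ x → InHypSupport (κ k ∸ μ k) (slack μ κ k) (ν k ∸ μ k) x →
    ∀ {out} → OutputOK (suc k) (suc k + r) (acc [ k ]≔ (c + ν k + κ k) ∸ (μ k + x)) out → OutputOK k (k + suc r) acc out
  outputOK-step {k} {r} {c} {acc} 1≤k carry x x∈ {out} ok = record
    { below = λ i i<k → trans (below i (ℕ.m<n⇒m<1+n i<k)) ([]≔-other acc _ (ℕ.<⇒≢ i<k))
    ; above = λ i k+1+r<i → trans (above i (ℕ.≤-trans (s≤s (ℕ.≤-reflexive (sym (ℕ.+-suc k r)))) k+1+r<i))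
                                  ([]≔-other acc _ (ℕ.>⇒≢ (ℕ.≤-<-trans (ℕ.m≤m+n k (suc r)) k+1+r<i)))
    ; entries = entries′
    }
    where
    open OutputOK ok
    entries′ : ∀ i → k ≤ i → i ≤ k + suc r → EntryOK i (out i)
    entries′ i k≤i i≤k+1+r with ℕ.m≤n⇒m<n∨m≡n k≤i
    ... | inj₁ k<i  = entries i k<i (ℕ.≤-trans i≤k+1+r (ℕ.≤-reflexive (ℕ.+-suc k r)))
    ... | inj₂ refl = subst (EntryOK k) (sym (trans (below k (ℕ.n<1+n k)) ([]≔-same acc k _)))
                            (newEntryOK 1≤k carry x x∈)

  insertLevel-output : ∀ q r k c acc → 1 ≤ k → VanishesFrom (k + r) κ → CarryOK k c →
    Supported (OutputOK k (k + r) acc) (insertLevel q μ κ ν r k c acc)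
  insertLevel-output q zero k c acc 1≤k κ↓k carry = supported-ret (record
    { below = λ i i<k → []≔-other acc _ (ℕ.<⇒≢ i<k)
    ; above = λ i k+0<i → []≔-other acc _ (ℕ.>⇒≢ (ℕ.≤-<-trans (ℕ.m≤m+n k 0) k+0<i))
    ; entries = entries
    })
    where
    entries : ∀ i → k ≤ i → i ≤ k + 0 → EntryOK i ((acc [ k ]≔ ν k + c) i)
    entries i k≤i i≤k+0 with ℕ.≤-antisym k≤i (ℕ.≤-trans i≤k+0 (ℕ.≤-reflexive (ℕ.+-identityʳ k)))
    ... | refl = subst (EntryOK k) (sym ([]≔-same acc k _))
                       (lastEntryOK k c (λ i h → κ↓k i (ℕ.≤-trans (ℕ.≤-reflexive (ℕ.+-identityʳ k)) h)) carry)
  insertLevel-output q (suc r) k c acc 1≤k κ↓k carry =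
    supported-bind (qHyp q (κ k ∸ μ k) (slack μ κ k) (ν k ∸ μ k)) _ (qHyp-support q _ _ _) λ x x∈ →
      All.map (outputOK-step 1≤k carry x x∈) (insertLevel-output q r (suc k) x _ (s≤s z≤n)
        (λ i h → κ↓k i (ℕ.≤-trans (ℕ.≤-reflexive (ℕ.+-suc k r)) h)) (nextCarryOK 1≤k carry x x∈))

  module FinalOutput {j} (1≤j : 1 ≤ j) (κ↓ : VanishesFrom (1 + (j ∸ 1)) κ) (ν↓j : VanishesFrom (suc j) ν) (ν0≡0 : ν 0 ≡ 0)
                     {out : Seq} (ok : OutputOK 1 (1 + (j ∸ 1)) ν out) where
    open OutputOK ok

    private
      1+[j∸1]≡j : 1 + (j ∸ 1) ≡ j
      1+[j∸1]≡j = ℕ.m+[n∸m]≡n 1≤j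

      out≡ν : ∀ i → j < i → out i ≡ ν i
      out≡ν i j<i = above i (subst (_< i) (sym 1+[j∸1]≡j) j<i)

      entryOK : ∀ i → 1 ≤ i → i ≤ j → EntryOK i (out i)
      entryOK i 1≤i i≤j = entries i 1≤i (subst (i ≤_) (sym 1+[j∸1]≡j) i≤j)

      out↓j : VanishesFrom (suc j) out
      out↓j i j<i = trans (out≡ν i j<i) (ν↓j i j<i)

      out[1+i]≤ : ∀ (ρ : Seq) i → (suc i ≤ j → out (suc i) ≤ ρ i) → out (suc i) ≤ ρ i
      out[1+i]≤ ρ i inside with suc i ℕ.≤? j
      ... | yes 1+i≤j = inside 1+i≤j
      ... | no  1+i≰j = ℕ.≤-trans (ℕ.≤-reflexive (out↓j (suc i) (ℕ.≰⇒> 1+i≰j))) z≤n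

    output-fits : Fits rows j out
    output-fits = record
      { at-0 = trans (below 0 (s≤s z≤n)) ν0≡0
      ; beyond-a = out↓rows
      ; beyond-b = out↓j
      }
      where
      out↓rows : VanishesFrom (suc rows) out
      out↓rows i rows<i with i ℕ.≤? j
      ... | yes i≤j = EntryOK.vanishes (entryOK i (ℕ.≤-trans (s≤s z≤n) rows<i) i≤j) rows<i
      ... | no  i≰j = out↓j i (ℕ.≰⇒> i≰j)

    κ≺output : κ ≺ out
    κ≺output i 1≤i = κ≤out , out[1+i]≤ κ i (λ 1+i≤j → EntryOK.≤κ (entryOK (suc i) (s≤s z≤n) 1+i≤j) i refl 1≤i)
      where
      κ≤out : κ i ≤ out i
      κ≤out with i ℕ.≤? j
      ... | yes i≤j = EntryOK.κ≤ (entryOK i 1≤i i≤j)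
      ... | no  i≰j = ℕ.≤-trans (ℕ.≤-reflexive (κ↓ i (ℕ.≤-trans (ℕ.≤-reflexive 1+[j∸1]≡j) (ℕ.<⇒≤ (ℕ.≰⇒> i≰j))))) z≤n

    ν≺output : ν ≺ out
    ν≺output i 1≤i = ν≤out , out[1+i]≤ ν i (λ 1+i≤j → EntryOK.≤ν (entryOK (suc i) (s≤s z≤n) 1+i≤j) i refl 1≤i)
      where
      ν≤out : ν i ≤ out i
      ν≤out with i ℕ.≤? j
      ... | yes i≤j = EntryOK.ν≤ (entryOK i 1≤i i≤j)
      ... | no  i≰j = ℕ.≤-reflexive (sym (out≡ν i (ℕ.≰⇒> i≰j)))

cell-output : ∀ q a ℓ j {μ κ ν} → 1 ≤ ℓ → 1 ≤ j → μ ≺ κ → μ ≺ ν →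
  Fits (ℓ ∸ 1) (j ∸ 1) μ → Fits ℓ (j ∸ 1) κ → Fits (ℓ ∸ 1) j ν →
  Supported (λ out → Fits ℓ j out × κ ≺ out × ν ≺ out) (cell q a j μ κ ν)
cell-output q a ℓ j {μ} {κ} {ν} 1≤ℓ 1≤j μ≺κ μ≺ν fμ fκ fν =
  All.map (λ ok → output-fits ok , κ≺output ok , ν≺output ok) (insertLevel-output q (j ∸ 1) 1 a ν (s≤s z≤n) κ↓ carry)
  where
  open Fits
  κ↓ : VanishesFrom (1 + (j ∸ 1)) κ
  κ↓ = beyond-b fκ
  open CellOutput μ κ ν μ≺κ μ≺ν ℓ (VanishesFrom-pred 1≤ℓ (beyond-a fμ)) (VanishesFrom-pred 1≤ℓ (beyond-a fν)) (beyond-a fκ)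
  open FinalOutput 1≤j κ↓ (beyond-b fν) (at-0 fν)
  carry : CarryOK 1 a
  carry = record { +μ≤κ = λ { zero refl () } ; +μ≤ν = λ { zero refl () } ; vanishes = λ ℓ<1 → ⊥-elim (ℕ.<⇒≱ ℓ<1 1≤ℓ) }

-- g ℓ j is level j of the pattern after ℓ insertions
Grid : Set
Grid = ℕ → ℕ → Seq

infix 4 _≈_
_≈_ : Grid → Grid → Set
g ≈ g′ = ∀ ℓ j → g ℓ j ≗ g′ ℓ j

setCell : Grid → ℕ → ℕ → Seq → Grid
setCell g ℓ j s ℓ′ j′ = if (ℓ′ ≡ᵇ ℓ) ∧ (j′ ≡ᵇ j) then s else g ℓ′ j′

setCell-same : ∀ g ℓ j s → setCell g ℓ j s ℓ j ≡ s
setCell-same g ℓ j s rewrite ≡ᵇ-refl ℓ | ≡ᵇ-refl j = refl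

setCell-other : ∀ g {ℓ j} s {ℓ′ j′} → ℓ′ ≢ ℓ ⊎ j′ ≢ j → setCell g ℓ j s ℓ′ j′ ≡ g ℓ′ j′
setCell-other g s (inj₁ ℓ′≢ℓ) rewrite ≢⇒≡ᵇ≡false ℓ′≢ℓ = refl
setCell-other g {ℓ} s {ℓ′} (inj₂ j′≢j) with ℓ′ ≡ᵇ ℓ
... | true  rewrite ≢⇒≡ᵇ≡false j′≢j = refl
... | false = refl

setCell-cong-at : ∀ g g′ ℓ j {s s′} ℓ′ j′ → g ℓ′ j′ ≗ g′ ℓ′ j′ → s ≗ s′ → setCell g ℓ j s ℓ′ j′ ≗ setCell g′ ℓ j s′ ℓ′ j′
setCell-cong-at g g′ ℓ j ℓ′ j′ g≗ s≗ with (ℓ′ ≡ᵇ ℓ) ∧ (j′ ≡ᵇ j)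
... | true  = s≗
... | false = g≗

setCell-cong : ∀ {g g′} ℓ j {s s′} → g ≈ g′ → s ≗ s′ → setCell g ℓ j s ≈ setCell g′ ℓ j s′
setCell-cong {g} {g′} ℓ j g≈ s≗ ℓ′ j′ = setCell-cong-at g g′ ℓ j ℓ′ j′ (g≈ ℓ′ j′) s≗

setCell-comm-elsewhere : ∀ g ℓa ja ℓb jb s t ℓ′ j′ → ℓ′ ≢ ℓa ⊎ j′ ≢ ja →
  setCell (setCell g ℓa ja s) ℓb jb t ℓ′ j′ ≗ setCell (setCell g ℓb jb t) ℓa ja s ℓ′ j′
setCell-comm-elsewhere g ℓa ja ℓb jb s t ℓ′ j′ ≢A i =
  trans (setCell-cong-at (setCell g ℓa ja s) g ℓb jb ℓ′ j′ (cong-app (setCell-other g s ≢A)) (λ _ → refl) i)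
        (cong-app (sym (setCell-other (setCell g ℓb jb t) s ≢A)) i)

setCell-comm : ∀ g {ℓa ja ℓb jb} s t → ℓa ≢ ℓb ⊎ ja ≢ jb →
               setCell (setCell g ℓa ja s) ℓb jb t ≈ setCell (setCell g ℓb jb t) ℓa ja s
setCell-comm g {ℓa} {ja} {ℓb} {jb} s t A≢B ℓ′ j′ with ℓ′ ℕ.≟ ℓa | j′ ℕ.≟ ja
... | yes refl | yes refl = cong-app (begin
  setCell gA ℓb jb t ℓa ja  ≡⟨ setCell-other gA t A≢B ⟩
  gA ℓa ja                  ≡⟨ setCell-same g ℓa ja s ⟩
  s                         ≡⟨ setCell-same gB ℓa ja s ⟨
  setCell gB ℓa ja s ℓa ja  ∎)
  where
  open ≡-Reasoning
  gA gB : Grid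
  gA = setCell g ℓa ja s
  gB = setCell g ℓb jb t
... | no ℓ′≢ℓa | _        = setCell-comm-elsewhere g ℓa ja ℓb jb s t ℓ′ j′ (inj₁ ℓ′≢ℓa)
... | yes _    | no j′≢ja = setCell-comm-elsewhere g ℓa ja ℓb jb s t ℓ′ j′ (inj₂ j′≢ja)

-- a random rule giving the row at grid position (ℓ, j) from those at (ℓ-1, j-1), (ℓ, j-1), (ℓ-1, j)
Kernel : Set
Kernel = ℕ → ℕ → Seq → Seq → Seq → Dist Seq

KernelCong : Kernel → Set
KernelCong C = ∀ ℓ j {μ κ ν μ′ κ′ ν′} → μ ≗ μ′ → κ ≗ κ′ → ν ≗ ν′ →
  {H H′ : Seq → ℚ} → (∀ {s s′} → s ≗ s′ → H s ≡ H′ s′) → 𝔼 (C ℓ j μ κ ν) H ≡ 𝔼 (C ℓ j μ′ κ′ ν′) H′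

sample : Kernel → ℕ → ℕ → Grid → Dist Seq
sample C ℓ j g = C ℓ j (g (ℓ ∸ 1) (j ∸ 1)) (g ℓ (j ∸ 1)) (g (ℓ ∸ 1) j)

-- Sweeps over the grid in continuation-passing style: the value is the expectation of the
-- final continuation K.
atCell : Kernel → ℕ → ℕ → Grid → (Grid → ℚ) → ℚ
atCell C ℓ j g K = 𝔼 (sample C ℓ j g) (λ s → K (setCell g ℓ j s))

alongRow : Kernel → (ℓ j c : ℕ) → Grid → (Grid → ℚ) → ℚ
alongRow C ℓ j zero    g K = K g
alongRow C ℓ j (suc c) g K = atCell C ℓ j g (λ g′ → alongRow C ℓ (suc j) c g′ K)

alongColumn : Kernel → (ℓ j c : ℕ) → Grid → (Grid → ℚ) → ℚ
alongColumn C ℓ j zero    g K = K g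
alongColumn C ℓ j (suc c) g K = atCell C ℓ j g (λ g′ → alongColumn C (suc ℓ) j c g′ K)

byRows : Kernel → (ℓ r m : ℕ) → Grid → (Grid → ℚ) → ℚ
byRows C ℓ zero    m g K = K g
byRows C ℓ (suc r) m g K = alongRow C ℓ 1 m g (λ g′ → byRows C (suc ℓ) r m g′ K)

byColumns : Kernel → (ℓ j c r : ℕ) → Grid → (Grid → ℚ) → ℚ
byColumns C ℓ j zero    r g K = K g
byColumns C ℓ j (suc c) r g K = alongColumn C ℓ j r g (λ g′ → byColumns C ℓ (suc j) c r g′ K)

Agree : (Grid → ℚ) → (Grid → ℚ) → Set
Agree K K′ = ∀ {h h′} → h ≈ h′ → K h ≡ K′ h′

sample-setCell-laterRow : ∀ C ℓ j g {ℓ′ j′ s} → ℓ < ℓ′ → sample C ℓ j (setCell g ℓ′ j′ s) ≡ sample C ℓ j g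
sample-setCell-laterRow C ℓ j g {s = s} ℓ<ℓ′ =
  cong₃ (C ℓ j) (setCell-other g s (inj₁ (ℕ.<⇒≢ (ℕ.≤-<-trans (ℕ.m∸n≤m ℓ 1) ℓ<ℓ′))))
                (setCell-other g s (inj₁ (ℕ.<⇒≢ ℓ<ℓ′)))
                (setCell-other g s (inj₁ (ℕ.<⇒≢ (ℕ.≤-<-trans (ℕ.m∸n≤m ℓ 1) ℓ<ℓ′))))

sample-setCell-laterColumn : ∀ C ℓ j g {ℓ′ j′ s} → j < j′ → sample C ℓ j (setCell g ℓ′ j′ s) ≡ sample C ℓ j g
sample-setCell-laterColumn C ℓ j g {s = s} j<j′ =
  cong₃ (C ℓ j) (setCell-other g s (inj₂ (ℕ.<⇒≢ (ℕ.≤-<-trans (ℕ.m∸n≤m j 1) j<j′))))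
                (setCell-other g s (inj₂ (ℕ.<⇒≢ (ℕ.≤-<-trans (ℕ.m∸n≤m j 1) j<j′))))
                (setCell-other g s (inj₂ (ℕ.<⇒≢ j<j′)))

module Sweeps (C : Kernel) (C-cong : KernelCong C) where

  atCell-cong : ∀ ℓ j {g g′ K K′} → g ≈ g′ → Agree K K′ → atCell C ℓ j g K ≡ atCell C ℓ j g′ K′
  atCell-cong ℓ j g≈ K≈ = C-cong ℓ j (g≈ _ _) (g≈ _ _) (g≈ _ _) (λ s≗ → K≈ (setCell-cong ℓ j g≈ s≗))

  alongRow-cong : ∀ ℓ j c {g g′ K K′} → g ≈ g′ → Agree K K′ → alongRow C ℓ j c g K ≡ alongRow C ℓ j c g′ K′
  alongRow-cong ℓ j zero    g≈ K≈ = K≈ g≈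
  alongRow-cong ℓ j (suc c) g≈ K≈ = atCell-cong ℓ j g≈ (λ h≈ → alongRow-cong ℓ (suc j) c h≈ K≈)

  alongColumn-cong : ∀ ℓ j c {g g′ K K′} → g ≈ g′ → Agree K K′ → alongColumn C ℓ j c g K ≡ alongColumn C ℓ j c g′ K′
  alongColumn-cong ℓ j zero    g≈ K≈ = K≈ g≈
  alongColumn-cong ℓ j (suc c) g≈ K≈ = atCell-cong ℓ j g≈ (λ h≈ → alongColumn-cong (suc ℓ) j c h≈ K≈)

  byRows-cong : ∀ ℓ r m {g g′ K K′} → g ≈ g′ → Agree K K′ → byRows C ℓ r m g K ≡ byRows C ℓ r m g′ K′
  byRows-cong ℓ zero    m g≈ K≈ = K≈ g≈
  byRows-cong ℓ (suc r) m g≈ K≈ = alongRow-cong ℓ 1 m g≈ (λ h≈ → byRows-cong (suc ℓ) r m h≈ K≈)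

  byColumns-cong : ∀ ℓ j c r {g g′ K K′} → g ≈ g′ → Agree K K′ → byColumns C ℓ j c r g K ≡ byColumns C ℓ j c r g′ K′
  byColumns-cong ℓ j zero    r g≈ K≈ = K≈ g≈
  byColumns-cong ℓ j (suc c) r g≈ K≈ = alongColumn-cong ℓ j r g≈ (λ h≈ → byColumns-cong ℓ (suc j) c r h≈ K≈)

  atCell-ext : ∀ ℓ j g {K K′} → K ≗ K′ → atCell C ℓ j g K ≡ atCell C ℓ j g K′
  atCell-ext ℓ j g K≗K′ = 𝔼-cong (sample C ℓ j g) (λ s → K≗K′ (setCell g ℓ j s))

  alongRow-ext : ∀ ℓ j c g {K K′} → K ≗ K′ → alongRow C ℓ j c g K ≡ alongRow C ℓ j c g K′
  alongRow-ext ℓ j zero    g K≗K′ = K≗K′ g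
  alongRow-ext ℓ j (suc c) g K≗K′ = atCell-ext ℓ j g (λ h → alongRow-ext ℓ (suc j) c h K≗K′)

  alongColumn-ext : ∀ ℓ j c g {K K′} → K ≗ K′ → alongColumn C ℓ j c g K ≡ alongColumn C ℓ j c g K′
  alongColumn-ext ℓ j zero    g K≗K′ = K≗K′ g
  alongColumn-ext ℓ j (suc c) g K≗K′ = atCell-ext ℓ j g (λ h → alongColumn-ext (suc ℓ) j c h K≗K′)

  -- cells neither of which reads the other's position can be sampled in either order
  atCell-comm : ∀ {ℓa ja ℓb jb} → ja < jb → ℓb < ℓa → ∀ g {K} → K Preserves _≈_ ⟶ _≡_ →
    atCell C ℓa ja g (λ g₁ → atCell C ℓb jb g₁ K) ≡ atCell C ℓb jb g (λ g₁ → atCell C ℓa ja g₁ K)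
  atCell-comm {ℓa} {ja} {ℓb} {jb} ja<jb ℓb<ℓa g {K} K-resp = begin
    𝔼 (sample C ℓa ja g) (λ s → 𝔼 (sample C ℓb jb (setCell g ℓa ja s)) (λ t → K (setCell (setCell g ℓa ja s) ℓb jb t)))
      ≡⟨ 𝔼-cong (sample C ℓa ja g) (λ s → cong (λ d → 𝔼 d _) (sample-setCell-laterRow C ℓb jb g ℓb<ℓa)) ⟩
    𝔼 (sample C ℓa ja g) (λ s → 𝔼 (sample C ℓb jb g) (λ t → K (setCell (setCell g ℓa ja s) ℓb jb t)))
      ≡⟨ 𝔼-comm (sample C ℓa ja g) (sample C ℓb jb g) _ ⟩
    𝔼 (sample C ℓb jb g) (λ t → 𝔼 (sample C ℓa ja g) (λ s → K (setCell (setCell g ℓa ja s) ℓb jb t)))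
      ≡⟨ 𝔼-cong (sample C ℓb jb g) (λ t → 𝔼-cong (sample C ℓa ja g) (λ s →
           K-resp (setCell-comm g s t (inj₁ (ℕ.>⇒≢ ℓb<ℓa))))) ⟩
    𝔼 (sample C ℓb jb g) (λ t → 𝔼 (sample C ℓa ja g) (λ s → K (setCell (setCell g ℓb jb t) ℓa ja s)))
      ≡⟨ 𝔼-cong (sample C ℓb jb g) (λ t → cong (λ d → 𝔼 d _) (sym (sample-setCell-laterColumn C ℓa ja g ja<jb))) ⟩
    𝔼 (sample C ℓb jb g) (λ t → 𝔼 (sample C ℓa ja (setCell g ℓb jb t)) (λ s → K (setCell (setCell g ℓb jb t) ℓa ja s)))
    ∎
    where open ≡-Reasoning

  atCell-alongColumn-comm : ∀ ℓb jb ℓ j r → j < jb → ℓb < ℓ → ∀ g {K} → K Preserves _≈_ ⟶ _≡_ →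
    atCell C ℓb jb g (λ g′ → alongColumn C ℓ j r g′ K) ≡ alongColumn C ℓ j r g (λ g′ → atCell C ℓb jb g′ K)
  atCell-alongColumn-comm ℓb jb ℓ j zero    j<jb ℓb<ℓ g K-resp = refl
  atCell-alongColumn-comm ℓb jb ℓ j (suc r) j<jb ℓb<ℓ g K-resp =
    trans (sym (atCell-comm j<jb ℓb<ℓ g (λ h≈ → alongColumn-cong (suc ℓ) j r h≈ K-resp)))
          (atCell-ext ℓ j g (λ h → atCell-alongColumn-comm ℓb jb (suc ℓ) j r j<jb (ℕ.m<n⇒m<1+n ℓb<ℓ) h K-resp))

  alongRow-alongColumn-comm : ∀ ℓ₀ j′ c ℓ j r → j < j′ → ℓ₀ < ℓ → ∀ g {K} → K Preserves _≈_ ⟶ _≡_ →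
    alongRow C ℓ₀ j′ c g (λ g′ → alongColumn C ℓ j r g′ K) ≡ alongColumn C ℓ j r g (λ g′ → alongRow C ℓ₀ j′ c g′ K)
  alongRow-alongColumn-comm ℓ₀ j′ zero    ℓ j r j<j′ ℓ₀<ℓ g K-resp = refl
  alongRow-alongColumn-comm ℓ₀ j′ (suc c) ℓ j r j<j′ ℓ₀<ℓ g K-resp =
    trans (atCell-ext ℓ₀ j′ g (λ h → alongRow-alongColumn-comm ℓ₀ (suc j′) c ℓ j r (ℕ.m<n⇒m<1+n j<j′) ℓ₀<ℓ h K-resp))
          (atCell-alongColumn-comm ℓ₀ j′ ℓ j r j<j′ ℓ₀<ℓ g (λ h≈ → alongRow-cong ℓ₀ (suc j′) c h≈ K-resp))

  alongRow-byColumns : ∀ ℓ₀ j c r g {K} → K Preserves _≈_ ⟶ _≡_ →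
    alongRow C ℓ₀ j c g (λ g′ → byColumns C (suc ℓ₀) j c r g′ K) ≡ byColumns C ℓ₀ j c (suc r) g K
  alongRow-byColumns ℓ₀ j zero    r g K-resp = refl
  alongRow-byColumns ℓ₀ j (suc c) r g K-resp = atCell-ext ℓ₀ j g λ h →
    trans (alongRow-alongColumn-comm ℓ₀ (suc j) c (suc ℓ₀) j r (ℕ.n<1+n j) (ℕ.n<1+n ℓ₀) h
                                     (λ h≈ → byColumns-cong (suc ℓ₀) (suc j) c r h≈ K-resp))
          (alongColumn-ext (suc ℓ₀) j r h (λ h′ → alongRow-byColumns ℓ₀ (suc j) c r h′ K-resp))

  byRows≡byColumns : ∀ ℓ r m g {K} → K Preserves _≈_ ⟶ _≡_ → byRows C ℓ r m g K ≡ byColumns C ℓ 1 m r g K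
  byRows≡byColumns ℓ zero    m g {K} K-resp = no-rows 1 m g
    where
    no-rows : ∀ j c g → K g ≡ byColumns C ℓ j c zero g K
    no-rows j zero    g = refl
    no-rows j (suc c) g = no-rows (suc j) c g
  byRows≡byColumns ℓ (suc r) m g K-resp =
    trans (alongRow-ext ℓ 1 m g (λ h → byRows≡byColumns (suc ℓ) r m h K-resp)) (alongRow-byColumns ℓ 1 m r g K-resp)

transposeGrid : Grid → Grid
transposeGrid g a b = g b a

transposeGrid-cong : ∀ {g g′} → g ≈ g′ → transposeGrid g ≈ transposeGrid g′
transposeGrid-cong g≈ a b = g≈ b a

transposeKernel : Kernel → Kernel
transposeKernel D ℓ j μ κ ν = D j ℓ μ ν κ

transposeKernel-cong : ∀ D → KernelCong D → KernelCong (transposeKernel D)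
transposeKernel-cong D D-cong ℓ j μ≗ κ≗ ν≗ H≡ = D-cong j ℓ μ≗ ν≗ κ≗ H≡

AgreeTransposed : (Grid → ℚ) → (Grid → ℚ) → Set
AgreeTransposed K′ K = ∀ {h′ h} → h′ ≈ transposeGrid h → K′ h′ ≡ K h

module Transposed (D : Kernel) (D-cong : KernelCong D) where

  atCell-transpose : ∀ ℓ j {g′ g K′ K} → g′ ≈ transposeGrid g → AgreeTransposed K′ K →
    atCell (transposeKernel D) j ℓ g′ K′ ≡ atCell D ℓ j g K
  atCell-transpose ℓ j {g′} {g} g′≈ K≈ = D-cong ℓ j (g′≈ _ _) (g′≈ _ _) (g′≈ _ _) (λ s≗ → K≈ (setCell-transpose s≗))
    where
    setCell-transpose : ∀ {s s′} → s ≗ s′ → setCell g′ j ℓ s ≈ transposeGrid (setCell g ℓ j s′)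
    setCell-transpose s≗ a b with a ≡ᵇ j | b ≡ᵇ ℓ
    ... | true  | true  = s≗
    ... | true  | false = g′≈ a b
    ... | false | true  = g′≈ a b
    ... | false | false = g′≈ a b

  alongRow-transpose : ∀ ℓ j c {g′ g K′ K} → g′ ≈ transposeGrid g → AgreeTransposed K′ K →
    alongRow (transposeKernel D) j ℓ c g′ K′ ≡ alongColumn D ℓ j c g K
  alongRow-transpose ℓ j zero    g′≈ K≈ = K≈ g′≈
  alongRow-transpose ℓ j (suc c) g′≈ K≈ = atCell-transpose ℓ j g′≈ (λ h≈ → alongRow-transpose (suc ℓ) j c h≈ K≈)

  byRows-transpose : ∀ j r n {g′ g K′ K} → g′ ≈ transposeGrid g → AgreeTransposed K′ K →
    byRows (transposeKernel D) j r n g′ K′ ≡ byColumns D 1 j r n g K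
  byRows-transpose j zero    n g′≈ K≈ = K≈ g′≈
  byRows-transpose j (suc r) n g′≈ K≈ = alongRow-transpose 1 j n g′≈ (λ h≈ → byRows-transpose (suc j) r n h≈ K≈)

qrskKernel : ℚ → Matrix → Kernel
qrskKernel q w ℓ j μ κ ν = cell q (w ℓ j) j μ κ ν

qrskKernel-cong : ∀ q w → KernelCong (qrskKernel q w)
qrskKernel-cong q w ℓ j μ≗ κ≗ ν≗ H≡ = 𝔼-insertLevel-cong q μ≗ κ≗ ν≗ (j ∸ 1) 1 (w ℓ j) ν≗ H≡

zero≺zero : ∀ {s t : Seq} → s ≗ (λ _ → 0) → t ≗ (λ _ → 0) → s ≺ t
zero≺zero s≗0 t≗0 i _ = ℕ.≤-reflexive (trans (s≗0 i) (sym (t≗0 i))) , ℕ.≤-reflexive (trans (t≗0 (suc i)) (sym (s≗0 i)))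

-- Rows before ℓ are complete and row ℓ is filled up to column j - 1, with the shape and
-- interlacing constraints of a sequence of GT patterns.
record Frontier (m ℓ j : ℕ) (g : Grid) : Set where
  field
    column-0        : ∀ ℓ′ → g ℓ′ 0 ≗ (λ _ → 0)
    prev-fits       : ∀ j′ → j′ ≤ m → Fits (ℓ ∸ 1) j′ (g (ℓ ∸ 1) j′)
    prev-interlaced : ∀ j′ → 1 ≤ j′ → j′ ≤ m → g (ℓ ∸ 1) (j′ ∸ 1) ≺ g (ℓ ∸ 1) j′
    cur-fits        : ∀ j′ → j′ < j → Fits ℓ j′ (g ℓ j′)
    cur-left        : ∀ j′ → 1 ≤ j′ → j′ < j → g ℓ (j′ ∸ 1) ≺ g ℓ j′
    cur-up          : ∀ j′ → j′ < j → g (ℓ ∸ 1) j′ ≺ g ℓ j′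

zeroGrid : Grid
zeroGrid _ _ _ = 0

zero-fits : ∀ {a b s} → s ≗ (λ _ → 0) → Fits a b s
zero-fits s≗0 = record { at-0 = s≗0 0 ; beyond-a = λ i _ → s≗0 i ; beyond-b = λ i _ → s≗0 i }

frontier-zeroGrid : ∀ m → Frontier m 1 1 zeroGrid
frontier-zeroGrid m = record
  { column-0        = λ _ _ → refl
  ; prev-fits       = λ _ _ → zero-fits (λ _ → refl)
  ; prev-interlaced = λ _ _ _ → zero≺zero (λ _ → refl) (λ _ → refl)
  ; cur-fits        = λ _ _ → zero-fits (λ _ → refl)
  ; cur-left        = λ _ _ _ → zero≺zero (λ _ → refl) (λ _ → refl)
  ; cur-up          = λ _ _ → zero≺zero (λ _ → refl) (λ _ → refl)
  }

frontier-nextRow : ∀ {m ℓ g} → Frontier m ℓ (suc m) g → Frontier m (suc ℓ) 1 g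
frontier-nextRow {ℓ = ℓ} {g} fr = record
  { column-0        = column-0
  ; prev-fits       = λ j′ j′≤m → cur-fits j′ (s≤s j′≤m)
  ; prev-interlaced = λ j′ 1≤j′ j′≤m → cur-left j′ 1≤j′ (s≤s j′≤m)
  ; cur-fits        = λ { zero _ → zero-fits (column-0 (suc ℓ)) ; (suc _) (s≤s ()) }
  ; cur-left        = λ { (suc _) _ (s≤s ()) }
  ; cur-up          = λ { zero _ → zero≺zero (column-0 ℓ) (column-0 (suc ℓ)) ; (suc _) (s≤s ()) }
  }
  where open Frontier fr

module _ {m ℓ j g} (1≤ℓ : 1 ≤ ℓ) (1≤j : 1 ≤ j) (fr : Frontier m ℓ j g) {out : Seq}
         (out-fits : Fits ℓ j out) (κ≺out : g ℓ (j ∸ 1) ≺ out) (ν≺out : g (ℓ ∸ 1) j ≺ out) where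

  open Frontier fr

  private
    g′ : Grid
    g′ = setCell g ℓ j out

    prevRow : ∀ j′ → g′ (ℓ ∸ 1) j′ ≡ g (ℓ ∸ 1) j′
    prevRow j′ = setCell-other g out (inj₁ (ℕ.<⇒≢ (∸1< 1≤ℓ)))

    earlier : ∀ {j′} → j′ < j → g′ ℓ j′ ≡ g ℓ j′
    earlier j′<j = setCell-other g out (inj₂ (ℕ.<⇒≢ j′<j))

    new : g′ ℓ j ≡ out
    new = setCell-same g ℓ j out

  frontier-step : Frontier m ℓ (suc j) g′
  frontier-step = record
    { column-0        = λ ℓ′ → trans (cong-app (setCell-other g out (inj₂ (ℕ.<⇒≢ 1≤j))) _) ∘ column-0 ℓ′
    ; prev-fits       = λ j′ j′≤m → subst (Fits (ℓ ∸ 1) j′) (sym (prevRow j′)) (prev-fits j′ j′≤m)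
    ; prev-interlaced = λ j′ 1≤j′ j′≤m → subst₂ _≺_ (sym (prevRow (j′ ∸ 1))) (sym (prevRow j′)) (prev-interlaced j′ 1≤j′ j′≤m)
    ; cur-fits        = fits′
    ; cur-left        = left′
    ; cur-up          = up′
    }
    where
    fits′ : ∀ j′ → j′ < suc j → Fits ℓ j′ (g′ ℓ j′)
    fits′ j′ j′<1+j with ℕ.m<1+n⇒m<n∨m≡n j′<1+j
    ... | inj₁ j′<j = subst (Fits ℓ j′) (sym (earlier j′<j)) (cur-fits j′ j′<j)
    ... | inj₂ refl = subst (Fits ℓ j′) (sym new) out-fits
    left′ : ∀ j′ → 1 ≤ j′ → j′ < suc j → g′ ℓ (j′ ∸ 1) ≺ g′ ℓ j′
    left′ j′ 1≤j′ j′<1+j with ℕ.m<1+n⇒m<n∨m≡n j′<1+j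
    ... | inj₁ j′<j = subst₂ _≺_ (sym (earlier (ℕ.≤-<-trans (ℕ.m∸n≤m j′ 1) j′<j))) (sym (earlier j′<j)) (cur-left j′ 1≤j′ j′<j)
    ... | inj₂ refl = subst₂ _≺_ (sym (earlier (∸1< 1≤j))) (sym new) κ≺out
    up′ : ∀ j′ → j′ < suc j → g′ (ℓ ∸ 1) j′ ≺ g′ ℓ j′
    up′ j′ j′<1+j with ℕ.m<1+n⇒m<n∨m≡n j′<1+j
    ... | inj₁ j′<j = subst₂ _≺_ (sym (prevRow j′)) (sym (earlier j′<j)) (cur-up j′ j′<j)
    ... | inj₂ refl = subst₂ _≺_ (sym (prevRow j′)) (sym new) ν≺out

module Symmetry {q : ℚ} (0≤q : 0ℚ ≤ℚ q) (q<1 : q <ℚ 1ℚ) (w : Matrix) (m : ℕ) where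

  C₁ C₂ : Kernel
  C₁ = transposeKernel (qrskKernel q (transpose w))
  C₂ = qrskKernel q w

  C₁-cong : KernelCong C₁
  C₁-cong = transposeKernel-cong (qrskKernel q (transpose w)) (qrskKernel-cong q (transpose w))

  module _ {ℓ j g} (1≤ℓ : 1 ≤ ℓ) (1≤j : 1 ≤ j) (j≤m : j ≤ m) (fr : Frontier m ℓ j g) where
    open Frontier fr
    open Fits

    private
      μ κ ν : Seq
      μ = g (ℓ ∸ 1) (j ∸ 1)
      κ = g ℓ (j ∸ 1)
      ν = g (ℓ ∸ 1) j
      μ-fits : Fits (ℓ ∸ 1) (j ∸ 1) μ
      μ-fits = prev-fits (j ∸ 1) (ℕ.≤-trans (ℕ.m∸n≤m j 1) j≤m)
      κ-fits : Fits ℓ (j ∸ 1) κ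
      κ-fits = cur-fits (j ∸ 1) (∸1< 1≤j)
      ν-fits : Fits (ℓ ∸ 1) j ν
      ν-fits = prev-fits j j≤m
      μ≺κ : μ ≺ κ
      μ≺κ = cur-up (j ∸ 1) (∸1< 1≤j)
      μ≺ν : μ ≺ ν
      μ≺ν = prev-interlaced j 1≤j j≤m

    𝔼-sample-transpose : ∀ (H : Seq → ℚ) → H Preserves _≗_ ⟶ _≡_ → 𝔼 (sample C₁ ℓ j g) H ≡ 𝔼 (sample C₂ ℓ j g) H
    𝔼-sample-transpose H H-resp =
      𝔼-cell-transpose 0≤q q<1 (w ℓ j) ℓ j μ κ ν H H-resp 1≤ℓ 1≤j μ≺κ μ≺ν
        (VanishesFrom-pred 1≤j (beyond-b κ-fits)) (VanishesFrom-pred 1≤ℓ (beyond-a ν-fits))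
        (VanishesFrom-pred 1≤j (beyond-b μ-fits)) (VanishesFrom-pred 1≤ℓ (beyond-a μ-fits))
        (trans (at-0 κ-fits) (sym (at-0 ν-fits)))

    sample-frontier : Supported (λ out → Frontier m ℓ (suc j) (setCell g ℓ j out)) (sample C₂ ℓ j g)
    sample-frontier = All.map (λ { (out-fits , κ≺out , ν≺out) → frontier-step 1≤ℓ 1≤j fr out-fits κ≺out ν≺out })
                              (cell-output q (w ℓ j) ℓ j 1≤ℓ 1≤j μ≺κ μ≺ν μ-fits κ-fits ν-fits)

  alongRow-sym : ∀ ℓ j c g {K₁ K₂} → 1 ≤ ℓ → 1 ≤ j → j + c ≤ suc m → Frontier m ℓ j g →
    K₁ Preserves _≈_ ⟶ _≡_ → (∀ h → Frontier m ℓ (j + c) h → K₁ h ≡ K₂ h) →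
    alongRow C₁ ℓ j c g K₁ ≡ alongRow C₂ ℓ j c g K₂
  alongRow-sym ℓ j zero    g 1≤ℓ 1≤j _ fr K₁-resp K₁≡K₂ =
    K₁≡K₂ g (subst (λ z → Frontier m ℓ z g) (sym (ℕ.+-identityʳ j)) fr)
  alongRow-sym ℓ j (suc c) g {K₁} {K₂} 1≤ℓ 1≤j j+1+c≤1+m fr K₁-resp K₁≡K₂ = begin
    𝔼 (sample C₁ ℓ j g) H₁  ≡⟨ 𝔼-sample-transpose 1≤ℓ 1≤j j≤m fr H₁ (λ s≗ → Sweeps.alongRow-cong C₁ C₁-cong ℓ (suc j) c
                                                                     (setCell-cong ℓ j (λ _ _ _ → refl) s≗) K₁-resp) ⟩
    𝔼 (sample C₂ ℓ j g) H₁  ≡⟨ 𝔼-cong-supported (sample C₂ ℓ j g) (sample-frontier 1≤ℓ 1≤j j≤m fr) (λ out fr′ →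
                                 alongRow-sym ℓ (suc j) c _ 1≤ℓ (s≤s z≤n) (subst (_≤ suc m) (ℕ.+-suc j c) j+1+c≤1+m) fr′
                                   K₁-resp (λ h → K₁≡K₂ h ∘ subst (λ z → Frontier m ℓ z h) (sym (ℕ.+-suc j c)))) ⟩
    𝔼 (sample C₂ ℓ j g) H₂  ∎
    where
    open ≡-Reasoning
    j≤m : j ≤ m
    j≤m = ℕ.≤-pred (ℕ.≤-trans (s≤s (ℕ.m≤m+n j c)) (subst (_≤ suc m) (ℕ.+-suc j c) j+1+c≤1+m))
    H₁ H₂ : Seq → ℚ
    H₁ s = alongRow C₁ ℓ (suc j) c (setCell g ℓ j s) K₁
    H₂ s = alongRow C₂ ℓ (suc j) c (setCell g ℓ j s) K₂

  byRows-sym : ∀ ℓ r g {K} → 1 ≤ ℓ → Frontier m ℓ 1 g → K Preserves _≈_ ⟶ _≡_ →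
    byRows C₁ ℓ r m g K ≡ byRows C₂ ℓ r m g K
  byRows-sym ℓ zero    g 1≤ℓ fr K-resp = refl
  byRows-sym ℓ (suc r) g 1≤ℓ fr K-resp =
    alongRow-sym ℓ 1 m g 1≤ℓ (s≤s z≤n) ℕ.≤-refl fr (λ h≈ → Sweeps.byRows-cong C₁ C₁-cong (suc ℓ) r m h≈ K-resp)
      (λ h fr′ → byRows-sym (suc ℓ) r h (s≤s z≤n) (frontier-nextRow fr′) K-resp)

upd-otherRow : ∀ t {j} k v {j′} → j′ ≢ j → upd t j k v j′ ≗ t j′
upd-otherRow t k v j′≢j i rewrite ≢⇒≡ᵇ≡false j′≢j = refl

upd-sameRow : ∀ t j k v → upd t j k v j ≗ t j [ k ]≔ v
upd-sameRow t j k v i rewrite ≡ᵇ-refl j = refl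

RowReplaced : Tab → ℕ → Seq → Tab → Set
RowReplaced t j s t′ = (∀ j′ → j′ ≢ j → t′ j′ ≗ t j′) × t′ j ≗ s

module _ (q : ℚ) (lam : Tab) (j : ℕ) (1≤j : 1 ≤ j) (κ : Seq) where

  𝔼-insLevel : ∀ r k c t {acc} → t (j ∸ 1) ≗ κ → t j ≗ acc → (H : Tab → ℚ) (H′ : Seq → ℚ) →
    (∀ {s t′} → RowReplaced t j s t′ → H t′ ≡ H′ s) →
    𝔼 (insLevel q lam j r k c t) H ≡ 𝔼 (insertLevel q (lam (j ∸ 1)) κ (lam j) r k c acc) H′

  -- M stands for the second parameter of insLevel, a local function that only reduces for concrete k
  𝔼-insLevel-draw : ∀ r k c t {acc} → t (j ∸ 1) ≗ κ → t j ≗ acc → (H : Tab → ℚ) (H′ : Seq → ℚ) →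
    (∀ {s t′} → RowReplaced t j s t′ → H t′ ≡ H′ s) →
    ∀ {M} → M ≡ slack (lam (j ∸ 1)) κ k →
    𝔼 (bind (qHyp q (t (j ∸ 1) k ∸ lam (j ∸ 1) k) M (lam j k ∸ lam (j ∸ 1) k))
            (λ x → insLevel q lam j r (suc k) x (upd t j k ((c + lam j k + t (j ∸ 1) k) ∸ (lam (j ∸ 1) k + x))))) H
      ≡ 𝔼 (insertLevel q (lam (j ∸ 1)) κ (lam j) (suc r) k c acc) H′

  𝔼-insLevel zero k c t {acc} t≗κ t≗acc H H′ H≡ =
    trans (𝔼-ret _ H) (trans (H≡ ((λ j′ → upd-otherRow t k _) , row)) (sym (𝔼-ret _ H′)))
    where
    row : upd t j k (lam j k + c) j ≗ acc [ k ]≔ lam j k + c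
    row i rewrite upd-sameRow t j k (lam j k + c) i with i ≡ᵇ k
    ... | true  = refl
    ... | false = t≗acc i
  𝔼-insLevel (suc r) zero          c t t≗κ t≗acc H H′ H≡ = 𝔼-insLevel-draw r zero c t t≗κ t≗acc H H′ H≡ refl
  𝔼-insLevel (suc r) (suc zero)    c t t≗κ t≗acc H H′ H≡ = 𝔼-insLevel-draw r (suc zero) c t t≗κ t≗acc H H′ H≡ refl
  𝔼-insLevel (suc r) (suc (suc k)) c t t≗κ t≗acc H H′ H≡ =
    𝔼-insLevel-draw r (suc (suc k)) c t t≗κ t≗acc H H′ H≡ (cong (λ z → fin (lam (j ∸ 1) (suc k) ∸ z)) (t≗κ (suc (suc k))))

  𝔼-insLevel-draw r k c t {acc} t≗κ t≗acc H H′ H≡ {M} M≡ =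
    trans (𝔼-bind (qHyp q (t (j ∸ 1) k ∸ lam (j ∸ 1) k) M (lam j k ∸ lam (j ∸ 1) k)) _ H)
   (trans (cong₂ 𝔼 (cong₃ (qHyp q) (cong (_∸ lam (j ∸ 1) k) (t≗κ k)) M≡ refl) refl)
   (trans (𝔼-cong (qHyp q (κ k ∸ lam (j ∸ 1) k) (slack (lam (j ∸ 1)) κ k) (lam j k ∸ lam (j ∸ 1) k)) (λ x →
             𝔼-insLevel r (suc k) x _ (λ i → trans (upd-otherRow t k _ (ℕ.<⇒≢ (∸1< 1≤j)) i) (t≗κ i)) (row x) H H′
               (λ { (other , same) → H≡ ((λ j′ j′≢j i → trans (other j′ j′≢j i) (upd-otherRow t k _ j′≢j i)) , same) })))
          (sym (𝔼-bind (qHyp q (κ k ∸ lam (j ∸ 1) k) (slack (lam (j ∸ 1)) κ k) (lam j k ∸ lam (j ∸ 1) k)) _ H′))))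
    where
    row : ∀ x → upd t j k ((c + lam j k + t (j ∸ 1) k) ∸ (lam (j ∸ 1) k + x)) j
              ≗ acc [ k ]≔ (c + lam j k + κ k) ∸ (lam (j ∸ 1) k + x)
    row x i rewrite upd-sameRow t j k ((c + lam j k + t (j ∸ 1) k) ∸ (lam (j ∸ 1) k + x)) i with i ≡ᵇ k
    ... | true  = cong (λ z → (c + lam j k + z) ∸ (lam (j ∸ 1) k + x)) (t≗κ k)
    ... | false = t≗acc i

module Simulation (q : ℚ) (w : Matrix) (m : ℕ) (1≤m : 1 ≤ m) where

  C : Kernel
  C = qrskKernel q w

  open Sweeps C (qrskKernel-cong q w)

  module _ (ℓ : ℕ) (1≤ℓ : 1 ≤ ℓ) (lam : Tab) (g : Grid)
           (lam≗ : ∀ j′ → lam j′ ≗ g (ℓ ∸ 1) j′) (column-0 : ∀ ℓ′ → g ℓ′ 0 ≗ (λ _ → 0)) where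

    -- levels 1 … j - 1 of row ℓ are inserted: t is the table of insLevels, g₁ the grid
    record RowInProgress (j : ℕ) (t : Tab) (g₁ : Grid) : Set where
      field
        done      : ∀ j′ → 1 ≤ j′ → j′ < j → t j′ ≗ g₁ ℓ j′
        pending   : ∀ j′ → j′ ≡ 0 ⊎ j ≤ j′ → t j′ ≗ lam j′
        untouched : ∀ ℓ′ j′ → ℓ′ ≢ ℓ ⊎ (j′ ≡ 0 ⊎ j ≤ j′) → g₁ ℓ′ j′ ≗ g ℓ′ j′

    rowInProgress-start : RowInProgress 1 lam g
    rowInProgress-start = record
      { done      = λ { _ (s≤s z≤n) (s≤s ()) }
      ; pending   = λ _ _ _ → refl
      ; untouched = λ _ _ _ _ → refl
      }

    rowInProgress-step : ∀ {j t g₁ s t′} → 1 ≤ j → RowInProgress j t g₁ → RowReplaced t j s t′ →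
                         RowInProgress (suc j) t′ (setCell g₁ ℓ j s)
    rowInProgress-step {j} {t} {g₁} {s} {t′} 1≤j rip (other , same) = record
      { done      = done′
      ; pending   = pending′
      ; untouched = untouched′
      }
      where
      open RowInProgress rip
      done′ : ∀ j′ → 1 ≤ j′ → j′ < suc j → t′ j′ ≗ setCell g₁ ℓ j s ℓ j′
      done′ j′ 1≤j′ j′<1+j i with ℕ.m<1+n⇒m<n∨m≡n j′<1+j
      ... | inj₁ j′<j = trans (other j′ (ℕ.<⇒≢ j′<j) i)
                              (trans (done j′ 1≤j′ j′<j i) (sym (cong-app (setCell-other g₁ s (inj₂ (ℕ.<⇒≢ j′<j))) i)))
      ... | inj₂ refl = trans (same i) (sym (cong-app (setCell-same g₁ ℓ j′ s) i))
      pending′ : ∀ j′ → j′ ≡ 0 ⊎ suc j ≤ j′ → t′ j′ ≗ lam j′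
      pending′ j′ (inj₁ refl)  i = trans (other 0 (ℕ.<⇒≢ 1≤j) i) (pending 0 (inj₁ refl) i)
      pending′ j′ (inj₂ j<j′) i = trans (other j′ (ℕ.>⇒≢ j<j′) i) (pending j′ (inj₂ (ℕ.<⇒≤ j<j′)) i)
      untouched′ : ∀ ℓ′ j′ → ℓ′ ≢ ℓ ⊎ (j′ ≡ 0 ⊎ suc j ≤ j′) → setCell g₁ ℓ j s ℓ′ j′ ≗ g ℓ′ j′
      untouched′ ℓ′ j′ (inj₁ ℓ′≢ℓ) i =
        trans (cong-app (setCell-other g₁ s (inj₁ ℓ′≢ℓ)) i) (untouched ℓ′ j′ (inj₁ ℓ′≢ℓ) i)
      untouched′ ℓ′ j′ (inj₂ (inj₁ refl)) i =
        trans (cong-app (setCell-other g₁ s (inj₂ (ℕ.<⇒≢ 1≤j))) i) (untouched ℓ′ 0 (inj₂ (inj₁ refl)) i)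
      untouched′ ℓ′ j′ (inj₂ (inj₂ j<j′)) i =
        trans (cong-app (setCell-other g₁ s (inj₂ (ℕ.>⇒≢ j<j′))) i) (untouched ℓ′ j′ (inj₂ (inj₂ (ℕ.<⇒≤ j<j′))) i)

    rowInProgress-left : ∀ {j t g₁} → 1 ≤ j → RowInProgress j t g₁ → t (j ∸ 1) ≗ g₁ ℓ (j ∸ 1)
    rowInProgress-left {suc zero} {t} {g₁} _ rip i = begin
      t 0 i             ≡⟨ pending 0 (inj₁ refl) i ⟩
      lam 0 i           ≡⟨ lam≗ 0 i ⟩
      g (ℓ ∸ 1) 0 i     ≡⟨ column-0 (ℓ ∸ 1) i ⟩
      0                 ≡⟨ column-0 ℓ i ⟨
      g ℓ 0 i           ≡⟨ untouched ℓ 0 (inj₂ (inj₁ refl)) i ⟨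
      g₁ ℓ 0 i          ∎
      where
      open ≡-Reasoning
      open RowInProgress rip
    rowInProgress-left {suc (suc j)} _ rip = RowInProgress.done rip (suc j) (s≤s z≤n) ℕ.≤-refl

    𝔼-insLevels : ∀ n j t g₁ → 1 ≤ j → RowInProgress j t g₁ →
      (K : Tab → ℚ) (K′ : Grid → ℚ) → K′ Preserves _≈_ ⟶ _≡_ → (∀ {t′ g′} → RowInProgress (j + n) t′ g′ → K t′ ≡ K′ g′) →
      𝔼 (insLevels q lam (w ℓ) n j t) K ≡ alongRow C ℓ j n g₁ K′
    𝔼-insLevels zero j t g₁ 1≤j rip K K′ K′-resp K≡ =
      trans (𝔼-ret t K) (K≡ (subst (λ z → RowInProgress z t g₁) (sym (ℕ.+-identityʳ j)) rip))
    𝔼-insLevels (suc n) j t g₁ 1≤j rip K K′ K′-resp K≡ = begin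
      𝔼 (insLevels q lam (w ℓ) (suc n) j t) K
        ≡⟨ 𝔼-bind (insLevel q lam j (j ∸ 1) 1 (w ℓ j) t) _ K ⟩
      𝔼 (insLevel q lam j (j ∸ 1) 1 (w ℓ j) t) (λ t′ → 𝔼 (insLevels q lam (w ℓ) n (suc j) t′) K)
        ≡⟨ 𝔼-insLevel q lam j 1≤j (t (j ∸ 1)) (j ∸ 1) 1 (w ℓ j) t (λ _ → refl) (λ _ → refl) _ H (λ rep →
             𝔼-insLevels n (suc j) _ _ (s≤s z≤n) (rowInProgress-step 1≤j rip rep) K K′ K′-resp
               (λ {t′} {g′} → K≡ ∘ subst (λ z → RowInProgress z t′ g′) (sym (ℕ.+-suc j n)))) ⟩
      𝔼 (insertLevel q (lam (j ∸ 1)) (t (j ∸ 1)) (lam j) (j ∸ 1) 1 (w ℓ j) (t j)) H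
        ≡⟨ 𝔼-insertLevel-cong q μ≗ (rowInProgress-left 1≤j rip) ν≗ (j ∸ 1) 1 (w ℓ j) (λ i → trans (pending j (inj₂ ℕ.≤-refl) i) (ν≗ i))
             (λ s≗ → alongRow-cong ℓ (suc j) n (setCell-cong ℓ j (λ _ _ _ → refl) s≗) K′-resp) ⟩
      atCell C ℓ j g₁ (λ g′ → alongRow C ℓ (suc j) n g′ K′)
      ∎
      where
      open ≡-Reasoning
      open RowInProgress rip
      H : Seq → ℚ
      H s = alongRow C ℓ (suc j) n (setCell g₁ ℓ j s) K′
      prevRow : ∀ j′ → lam j′ ≗ g₁ (ℓ ∸ 1) j′
      prevRow j′ i = trans (lam≗ j′ i) (sym (untouched (ℓ ∸ 1) j′ (inj₁ (ℕ.<⇒≢ (∸1< 1≤ℓ))) i))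
      μ≗ : lam (j ∸ 1) ≗ g₁ (ℓ ∸ 1) (j ∸ 1)
      μ≗ = prevRow (j ∸ 1)
      ν≗ : lam j ≗ g₁ (ℓ ∸ 1) j
      ν≗ = prevRow j

  -- the state (lam, Qt) of rskRows before row ℓ, as a grid
  record Simulates (ℓ : ℕ) (lam Qt : Tab) (g : Grid) : Set where
    field
      current   : ∀ j′ → lam j′ ≗ g (ℓ ∸ 1) j′
      recording : ∀ ℓ′ → Qt ℓ′ ≗ g ℓ′ m
      future    : ∀ ℓ′ j′ → ℓ ≤ ℓ′ → g ℓ′ j′ ≗ (λ _ → 0)
      outside   : ∀ ℓ′ j′ → j′ ≡ 0 ⊎ m < j′ → g ℓ′ j′ ≗ (λ _ → 0)

  simulates-nextRow : ∀ {ℓ lam Qt g t′ g′} (1≤ℓ : 1 ≤ ℓ) (sim : Simulates ℓ lam Qt g) →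
    RowInProgress ℓ 1≤ℓ lam g (Simulates.current sim) (λ ℓ′ → Simulates.outside sim ℓ′ 0 (inj₁ refl)) (suc m) t′ g′ →
    Simulates (suc ℓ) t′ (λ ℓ′ k → if ℓ′ ≡ᵇ ℓ then t′ m k else Qt ℓ′ k) g′
  simulates-nextRow {ℓ} {lam} {Qt} {g} {t′} {g′} 1≤ℓ sim rip = record
    { current   = current′
    ; recording = recording′
    ; future    = λ ℓ′ j′ ℓ<ℓ′ i → trans (untouched ℓ′ j′ (inj₁ (ℕ.>⇒≢ ℓ<ℓ′)) i) (future ℓ′ j′ (ℕ.<⇒≤ ℓ<ℓ′) i)
    ; outside   = outside′
    }
    where
    open Simulates sim
    open RowInProgress rip
    outside′ : ∀ ℓ′ j′ → j′ ≡ 0 ⊎ m < j′ → g′ ℓ′ j′ ≗ (λ _ → 0)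
    outside′ ℓ′ j′ (inj₁ refl) i = trans (untouched ℓ′ 0 (inj₂ (inj₁ refl)) i) (outside ℓ′ 0 (inj₁ refl) i)
    outside′ ℓ′ j′ (inj₂ m<j′) i = trans (untouched ℓ′ j′ (inj₂ (inj₂ m<j′)) i) (outside ℓ′ j′ (inj₂ m<j′) i)
    current′ : ∀ j′ → t′ j′ ≗ g′ ℓ j′
    current′ j′ i with j′ ℕ.≟ 0 | j′ ℕ.≤? m
    ... | yes refl | _       = trans (pending 0 (inj₁ refl) i)
                                 (trans (current 0 i) (trans (outside (ℓ ∸ 1) 0 (inj₁ refl) i) (sym (outside′ ℓ 0 (inj₁ refl) i))))
    ... | no j′≢0  | yes j′≤m = done j′ (ℕ.n≢0⇒n>0 j′≢0) (s≤s j′≤m) i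
    ... | no _     | no j′≰m  = trans (pending j′ (inj₂ (ℕ.≰⇒> j′≰m))  i)
                                 (trans (current j′ i) (trans (outside (ℓ ∸ 1) j′ (inj₂ (ℕ.≰⇒> j′≰m)) i)
                                   (sym (outside′ ℓ j′ (inj₂ (ℕ.≰⇒> j′≰m)) i))))
    recording′ : ∀ ℓ′ → (λ k → if ℓ′ ≡ᵇ ℓ then t′ m k else Qt ℓ′ k) ≗ g′ ℓ′ m
    recording′ ℓ′ i with ℓ′ ℕ.≟ ℓ
    ... | yes refl rewrite ≡ᵇ-refl ℓ′ = done m 1≤m ℕ.≤-refl i
    ... | no ℓ′≢ℓ  rewrite ≢⇒≡ᵇ≡false ℓ′≢ℓ = trans (recording ℓ′ i) (sym (untouched ℓ′ m (inj₁ ℓ′≢ℓ) i))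

  𝔼-rskRows : ∀ s ℓ {lam Qt g} → 1 ≤ ℓ → Simulates ℓ lam Qt g → (F : Tab × Tab → ℚ) (F′ : Grid → ℚ) →
    F′ Preserves _≈_ ⟶ _≡_ → (∀ {lam′ Qt′ g′} → Simulates (ℓ + s) lam′ Qt′ g′ → F (lam′ , Qt′) ≡ F′ g′) →
    𝔼 (rskRows q m w s ℓ (lam , Qt)) F ≡ byRows C ℓ s m g F′
  𝔼-rskRows zero ℓ {lam} {Qt} {g} 1≤ℓ sim F F′ F′-resp F≡ =
    trans (𝔼-ret _ F) (F≡ (subst (λ z → Simulates z lam Qt g) (sym (ℕ.+-identityʳ ℓ)) sim))
  𝔼-rskRows (suc s) ℓ {lam} {Qt} {g} 1≤ℓ sim F F′ F′-resp F≡ =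
    trans (𝔼-bind (insert q m lam (w ℓ)) _ F)
          (𝔼-insLevels ℓ 1≤ℓ lam g current (λ ℓ′ → outside ℓ′ 0 (inj₁ refl)) m 1 lam g (s≤s z≤n)
             (rowInProgress-start ℓ 1≤ℓ lam g current (λ ℓ′ → outside ℓ′ 0 (inj₁ refl))) _ _
             (λ h≈ → byRows-cong (suc ℓ) s m h≈ F′-resp)
             (λ rip → 𝔼-rskRows s (suc ℓ) (s≤s z≤n) (simulates-nextRow 1≤ℓ sim rip) F F′ F′-resp
                         (λ {lam′} {Qt′} {g′} → F≡ ∘ subst (λ z → Simulates z lam′ Qt′ g′) (sym (ℕ.+-suc ℓ s)))))
    where open Simulates sim

-- the event qRSK = (P, Q), read off a grid with n rows and m columns
outcome : (n m : ℕ) → Tab → Tab → Grid → ℚ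
outcome n m P Q g = if agree m P (g n) ∧ agree n Q (λ ℓ → g ℓ m) then 1ℚ else 0ℚ

allL-cong : {A : Set} {p p′ : A → Bool} → (∀ x → p x ≡ p′ x) → (xs : List A) → allL p xs ≡ allL p′ xs
allL-cong p≡ []       = refl
allL-cong p≡ (x ∷ xs) = cong₂ _∧_ (p≡ x) (allL-cong p≡ xs)

agree-cong : ∀ m X {Y Y′} → (∀ j → Y j ≗ Y′ j) → agree m X Y ≡ agree m X Y′
agree-cong m X Y≗ = allL-cong (λ j → allL-cong (λ k → cong (X j k ≡ᵇ_) (Y≗ j k)) (range 1 j)) (range 1 m)

outcome-resp : ∀ n m P Q → outcome n m P Q Preserves _≈_ ⟶ _≡_
outcome-resp n m P Q h≈ =
  cong (λ b → if b then 1ℚ else 0ℚ) (cong₂ _∧_ (agree-cong m P (h≈ n)) (agree-cong n Q (λ ℓ → h≈ ℓ m)))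

outcome-transpose : ∀ n m P Q g → outcome n m P Q g ≡ outcome m n Q P (transposeGrid g)
outcome-transpose n m P Q g = cong (λ b → if b then 1ℚ else 0ℚ) (∧-comm (agree m P (g n)) (agree n Q (λ ℓ → g ℓ m)))

phi≡byRows : ∀ q n m w P Q → 1 ≤ m → phi q n m w P Q ≡ byRows (qrskKernel q w) 1 n m zeroGrid (outcome n m P Q)
phi≡byRows q n m w P Q 1≤m =
  trans (prob≡𝔼-indicator (qRSK q n m w) _)
        (Simulation.𝔼-rskRows q w m 1≤m n 1 (s≤s z≤n) initial _ (outcome n m P Q) (outcome-resp n m P Q)
           (λ sim → cong (λ b → if b then 1ℚ else 0ℚ)
                         (cong₂ _∧_ (agree-cong m P (Simulates.current sim)) (agree-cong n Q (Simulates.recording sim)))))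
  where
  open Simulation q w m 1≤m using (Simulates)
  initial : Simulates 1 zeroTab zeroTab zeroGrid
  initial = record
    { current = λ _ _ → refl ; recording = λ _ _ → refl ; future = λ _ _ _ _ → refl ; outside = λ _ _ _ _ → refl }

theorem1p1 : (q : ℚ) → 0ℚ ≤ℚ q → q <ℚ 1ℚ →
    (n m : ℕ) → 1 ≤ n → 1 ≤ m → (A : Matrix) → (P Q : Tab) →
    IsGT m P → IsGT n Q →
    phi q n m A P Q ≡ phi q m n (transpose A) Q P
theorem1p1 q 0≤q q<1 n m 1≤n 1≤m A P Q _ _ = begin
  phi q n m A P Q
    ≡⟨ phi≡byRows q n m A P Q 1≤m ⟩
  byRows C₂ 1 n m zeroGrid (outcome n m P Q)
    ≡⟨ Sweeps.byRows-cong C₂ (qrskKernel-cong q A) 1 n m (λ _ _ _ → refl)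
         (λ {h} h≈ → trans (outcome-resp n m P Q h≈) (outcome-transpose n m P Q _)) ⟩
  byRows C₂ 1 n m zeroGrid (outcome m n Q P ∘ transposeGrid)
    ≡⟨ byRows-sym 1 n zeroGrid (s≤s z≤n) (frontier-zeroGrid m) (outcome-resp m n Q P ∘ transposeGrid-cong) ⟨
  byRows C₁ 1 n m zeroGrid (outcome m n Q P ∘ transposeGrid)
    ≡⟨ Sweeps.byRows≡byColumns C₁ C₁-cong 1 n m zeroGrid (outcome-resp m n Q P ∘ transposeGrid-cong) ⟩
  byColumns C₁ 1 1 m n zeroGrid (outcome m n Q P ∘ transposeGrid)
    ≡⟨ Transposed.byRows-transpose C₁ C₁-cong 1 m n (λ _ _ _ → refl) (outcome-resp m n Q P) ⟨
  byRows (qrskKernel q (transpose A)) 1 m n zeroGrid (outcome m n Q P)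
    ≡⟨ phi≡byRows q m n (transpose A) Q P 1≤n ⟨
  phi q m n (transpose A) Q P
  ∎
  where
  open ≡-Reasoning
  open Symmetry 0≤q q<1 A m
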